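{- Let $m$ be a positive integer, $F=\mathbb{F}_{2^m}$, let $b\in F$ and put $\xi=b^4+b+1$. If $\xi\notin\{0,1\}$, then \[ K(\xi^4+\xi^3)\equiv\begin{cases}3\pmod{12}, & \text{if } m \text{ is odd},\\ 7\pmod{12}, & \text{if } m \text{ is even}.\end{cases} \]
   Context: $\mathrm{Tr}$ denotes the absolute trace from $F=\mathbb{F}_{2^m}$ to $\mathbb{F}_2$. For $a\in F\setminus\{0\}$, the Kloosterman sum is $K(a)=\sum_{x\in F\setminus\{0\}}(-1)^{\mathrm{Tr}(ax+1/x)}$. -}

module Defs where

open import Level using (0ℓ)
open import Data.Nat using (ℕ; zero; suc; _^_)
open import Data.Integer as ℤ using (ℤ; +_; -[1+_])
open import Data.List using (List; []; _∷_; length; upTo; map; foldr; filter)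
open import Data.List.Membership.Propositional using (_∈_)
open import Data.List.Relation.Unary.Unique.Propositional using (Unique)
open import Relation.Nullary using (¬_; Dec; yes; no; ¬?)
open import Relation.Binary.PropositionalEquality using (_≡_)
open import Algebra.Structures using (IsCommutativeRing)

record FiniteField (m : ℕ) : Set₁ where
  infixl 6 _+_
  infixl 7 _*_
  field
    Carrier   : Set
    _+_ _*_   : Carrier → Carrier → Carrier
    -_        : Carrier → Carrier
    0# 1#     : Carrier
    isCommutativeRing : IsCommutativeRing _≡_ _+_ _*_ -_ 0# 1#
    0≢1       : ¬ (0# ≡ 1#)
    inv       : Carrier → Carrier
    inv-r     : ∀ x → ¬ (x ≡ 0#) → x * inv x ≡ 1#
    _≟_       : (x y : Carrier) → Dec (x ≡ y)
    elements  : List Carrier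
    complete  : ∀ x → x ∈ elements
    unique    : Unique elements
    card      : length elements ≡ 2 ^ m

  pow : Carrier → ℕ → Carrier
  pow x zero    = 1#
  pow x (suc n) = x * pow x n

  Tr : Carrier → Carrier
  Tr x = foldr (λ i acc → pow x (2 ^ i) + acc) 0# (upTo m)

  -- (-1)^Tr(x), reading Tr(x) ∈ {0,1} ⊆ F
  signTr : Carrier → ℤ
  signTr x with Tr x ≟ 0#
  ... | yes _ = + 1
  ... | no  _ = -[1+ 0 ]

  K : Carrier → ℤ
  K a = foldr (λ x acc → signTr (a * x + inv x) ℤ.+ acc) (+ 0)
              (filter (λ x → ¬? (x ≟ 0#)) elements)

{-# OPTIONS --safe #-}
module Submission where

-- Mod 4: K(a) = 2^m − 1 − 2N, where N counts the x ≠ 0 with Tr(ax + 1/x) = 1, and N is even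
-- because x ↦ 1/(ax) acts freely on those x.
-- Mod 3: rotating (α, β, γ) acts freely on the solutions of α + β + γ = 1, αβγ = ξ (this is
-- translation by a 3-torsion point on an elliptic curve), so their number is divisible by 3.
-- Substituting α = s/(1+s), β = z/(1+s) turns the equation into z² + z = ξ(1+s)³/s, matching all
-- solutions except one with α = 1 and two with s = 1. By Artin–Schreier theory the latter equation
-- has 2^m − 1 + (−1)^Tr(ξ) K(ξ⁴ + ξ³) solutions, and Tr(ξ) = Tr(1) = 0 when m is even.

open import Defs
open import Algebra.Bundles using (CommutativeRing)
import Algebra.Properties.Ring
import Algebra.Solver.Ring
open import Algebra.Solver.Ring.AlmostCommutativeRing using (fromCommutativeRing; Induced-equivalence; _-Raw-AlmostCommutative⟶_)
open import Algebra.Structures using (IsCommutativeMonoid; IsCommutativeRing)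
open import Data.Bool using (true; false)
open import Data.Bool.Properties using (xor-∧-commutativeRing)
import Data.Integer as ℤ
open ℤ using (ℤ)
import Data.Integer.Properties as ℤ
open import Data.Integer.Divisibility.Signed as ℤ∣ using (divides)
import Data.Integer.Solver
open Data.Integer.Solver.+-*-Solver using () renaming (solve to ℤ-solve; con to ℤ-con; _:+_ to _⊕_; _:*_ to _⊗_; _:-_ to _⊖_; _:=_ to _⊜_)
open import Data.List using (List; []; _∷_; _++_; length; map; foldr; filter; cartesianProduct; applyUpTo; upTo)
open import Data.List.Membership.Propositional using (_∈_; find)
open import Data.List.Membership.Propositional.Properties using (∈-∃++; ∈-filter⁺; ∈-filter⁻; ∈-++⁺ˡ; ∈-++⁺ʳ; ∈-++⁻; ∈-map⁻; ∈-cartesianProduct⁺)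
open import Data.List.Properties using (length-map; length-++; filter-++; filter-≐; filter-none)
open import Data.List.Relation.Binary.Permutation.Propositional as ↭ using (_↭_; prep; swap; ↭-sym; ↭-trans)
open import Data.List.Relation.Binary.Permutation.Propositional.Properties using (shift; ∈-resp-↭; ↭-length)
open import Data.List.Relation.Binary.Subset.Propositional using (_⊆_)
open import Data.List.Relation.Unary.All as All using (All; []; _∷_)
open import Data.List.Relation.Unary.All.Properties using (¬All⇒Any¬)
open import Data.List.Relation.Unary.AllPairs using ([]; _∷_)
open import Data.List.Relation.Unary.Any using (here; there; any?)
open import Data.List.Relation.Unary.Unique.Propositional using (Unique)
import Data.List.Relation.Unary.Unique.Propositional.Properties as Unique
open import Data.Maybe using (just; nothing)
open import Data.Nat using (ℕ; zero; suc; _≤_; _<_; z≤n; s≤s; s≤s⁻¹; _^_; _%_)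
import Data.Nat as ℕ
import Data.Nat.Divisibility as ℕ∣
import Data.Nat.Properties as ℕ
open import Data.Product using (_×_; _,_; proj₁; proj₂; ∃)
open import Data.Product.Properties using (≡-dec)
open import Data.Sum using (_⊎_; inj₁; inj₂; [_,_]′)
open import Function using (_∘_; id; const)
open import Relation.Binary.Definitions using (DecidableEquality; WeaklyDecidable)
open import Relation.Binary.PropositionalEquality using (_≡_; _≢_; refl; sym; trans; cong; cong₂; subst; module ≡-Reasoning)
open import Relation.Nullary using (¬_; Dec; yes; no; ¬?; contradiction)
open import Relation.Nullary.Decidable using (decidable-stable)
open import Relation.Unary using (Decidable)
open ≡-Reasoning

-- Finite lists without repetition

-- Both residues are 3 modulo 4, and modulo 3 they are 0 and 1, so the two congruences combine. The
-- projective cubic behind αβγ = ξ has exactly three points at infinity, all flexes; they form a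
-- subgroup of order 3, which is why the affine solutions split into cosets of size 3. The
-- substitution gives γ = (1 + z)/(1 + s), hence αβγ = s(z² + z)/(1 + s)³, which is of
-- Artin-Schreier type in z. The constant ξ⁴ + ξ³ arises from ξ(1 + s)³/s = ξ/s + ξ + ξs + ξs².
-- Squaring preserves traces, so ξ/s and ξs may be replaced by ξ²/s² and ξ²s², leaving Tr(ξ) +
-- Tr((ξ² + ξ)s² + ξ²/s²). With v = s²/ξ² the last argument is av + 1/v for a = ξ²(ξ² + ξ). The
-- field is given only through a list of 2^m elements. Characteristic two, Fermat's identity, square
-- roots and an element of nonzero trace are therefore all obtained by reindexing or counting that
-- list.

private
  variable
    A B : Set

∈⇒↭∷ : {x : A} {xs : List A} → x ∈ xs → ∃ λ ys → xs ↭ x ∷ ys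
∈⇒↭∷ {x = x} x∈xs with ∈-∃++ x∈xs
... | as , bs , refl = as ++ bs , shift x as bs

⊆-uncons : {x : A} {xs ys zs : List A} → Unique (x ∷ xs) → x ∷ xs ⊆ ys → ys ↭ x ∷ zs → xs ⊆ zs
⊆-uncons (x∉xs ∷ _) xs⊆ys ys↭ y∈xs with ∈-resp-↭ ys↭ (xs⊆ys (there y∈xs))
... | here refl = contradiction refl (All.lookup x∉xs y∈xs)
... | there y∈zs  = y∈zs

unique-⊆⇒length≤ : {xs ys : List A} → Unique xs → xs ⊆ ys → length xs ≤ length ys
unique-⊆⇒length≤ [] _ = z≤n
unique-⊆⇒length≤ u@(_ ∷ u′) xs⊆ys with ∈⇒↭∷ (xs⊆ys (here refl))
... | zs , ys↭ = ℕ.≤-trans (s≤s (unique-⊆⇒length≤ u′ (⊆-uncons u xs⊆ys ys↭)))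
                         (ℕ.≤-reflexive (sym (↭-length ys↭)))

-- Pigeonhole: each entry of `xs` uses up its own entry of `ys`, and the length bound leaves none
-- over. Injective self-maps become permutations in this way.
unique-⊆∧length≥⇒↭ : {xs ys : List A} → Unique xs → xs ⊆ ys → length ys ≤ length xs → xs ↭ ys
unique-⊆∧length≥⇒↭ {ys = []} [] _ _ = ↭.refl
unique-⊆∧length≥⇒↭ u@(_ ∷ u′) xs⊆ys len with ∈⇒↭∷ (xs⊆ys (here refl))
... | zs , ys↭ = ↭-trans (prep _ (unique-⊆∧length≥⇒↭ u′ (⊆-uncons u xs⊆ys ys↭)
                            (s≤s⁻¹ (ℕ.≤-trans (ℕ.≤-reflexive (sym (↭-length ys↭))) len))))
                         (↭-sym ys↭)

unique-⊆⊇⇒↭ : {xs ys : List A} → Unique xs → Unique ys → xs ⊆ ys → ys ⊆ xs → xs ↭ ys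
unique-⊆⊇⇒↭ uxs uys xs⊆ys ys⊆xs =
  unique-⊆∧length≥⇒↭ uxs xs⊆ys (unique-⊆⇒length≤ uys ys⊆xs)

unique-map : (f : A → B) {xs : List A} →
             (∀ {x y} → x ∈ xs → y ∈ xs → f x ≡ f y → x ≡ y) →
             Unique xs → Unique (map f xs)
unique-map f inj [] = []
unique-map f {x ∷ xs} inj (x∉xs ∷ u) =
  All.tabulate fresh ∷ unique-map f (λ p q → inj (there p) (there q)) u
  where
  fresh : ∀ {y} → y ∈ map f xs → f x ≢ y
  fresh y∈ fx≡y with ∈-map⁻ f y∈
  ... | z , z∈xs , refl = All.lookup x∉xs z∈xs (inj (here refl) (there z∈xs) fx≡y)

map-⊆ : (f : A → B) {xs : List A} {ys : List B} → (∀ {x} → x ∈ xs → f x ∈ ys) → map f xs ⊆ ys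
map-⊆ f into y∈ with ∈-map⁻ f y∈
... | x , x∈xs , refl = into x∈xs

-- Injectivity is asked for on the entries only, since the substitution `ψ` is inverted only away
-- from s = 1.
injection⇒length≤ : (f : A → B) {xs : List A} {ys : List B} → Unique xs →
                    (∀ {x} → x ∈ xs → f x ∈ ys) →
                    (∀ {x y} → x ∈ xs → y ∈ xs → f x ≡ f y → x ≡ y) →
                    length xs ≤ length ys
injection⇒length≤ f {xs} {ys} u into inj = subst (_≤ length ys) (length-map f xs)
  (unique-⊆⇒length≤ (unique-map f inj u) (map-⊆ f into))

injection⇒↭ : (f : A → A) {xs : List A} → Unique xs →
              (∀ {x} → x ∈ xs → f x ∈ xs) →
              (∀ {x y} → x ∈ xs → y ∈ xs → f x ≡ f y → x ≡ y) →
              map f xs ↭ xs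
injection⇒↭ f {xs} u into inj =
  unique-⊆∧length≥⇒↭ (unique-map f inj u) (map-⊆ f into) (ℕ.≤-reflexive (sym (length-map f xs)))

-- Separates explicitly listed exceptions from the generic members; on lengths this yields the
-- corrections 1 and 2 in the point counts.
unique-remove : {P : A → Set} (P? : Decidable P) (ys : List A) {xs : List A} →
                Unique xs → Unique ys → ys ⊆ xs →
                (∀ {x} → x ∈ ys → ¬ P x) → (∀ {x} → x ∈ xs → ¬ P x → x ∈ ys) →
                xs ↭ ys ++ filter P? xs
unique-remove P? ys {xs} uxs uys ys⊆xs ys¬P ¬P∈ys =
  unique-⊆⊇⇒↭ uxs
    (Unique.++⁺ uys (Unique.filter⁺ P? uxs) λ (p , q) → ys¬P p (proj₂ (∈-filter⁻ P? {xs = xs} q)))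
    split
    ([ ys⊆xs , proj₁ ∘ ∈-filter⁻ P? ]′ ∘ ∈-++⁻ ys)
  where
  split : xs ⊆ ys ++ filter P? xs
  split {x} x∈xs with P? x
  ... | yes px = ∈-++⁺ʳ ys (∈-filter⁺ P? x∈xs px)
  ... | no ¬px = ∈-++⁺ˡ (¬P∈ys x∈xs ¬px)

-- Divisibility from free orbits

module _ (_≟_ : DecidableEquality A) where

  -- The hypotheses make the lists `orb x` classes of an equivalence relation on `xs`, all of size
  -- `suc n`. Splitting off the class of the head preserves them.
  orbits⇒∣length : (n : ℕ) (orb : A → List A) → (∀ x → length (orb x) ≡ suc n) →
    {xs : List A} → Unique xs →
    (∀ {x} → x ∈ xs → Unique (orb x) × orb x ⊆ xs) →
    (∀ {x y} → x ∈ xs → y ∈ orb x → x ∈ orb y × orb y ⊆ orb x) →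
    suc n ℕ∣.∣ length xs
  orbits⇒∣length n orb |orb| {xs₀} u₀ = go (length xs₀) ℕ.≤-refl u₀
    where
    -- Recursion runs on a bound for the length, because filtering out an orbit does not leave a
    -- structural sublist.
    go : ∀ k {xs} → length xs ≤ k → Unique xs →
         (∀ {x} → x ∈ xs → Unique (orb x) × orb x ⊆ xs) →
         (∀ {x y} → x ∈ xs → y ∈ orb x → x ∈ orb y × orb y ⊆ orb x) →
         suc n ℕ∣.∣ length xs
    go k {[]} _ _ _ _ = suc n ℕ∣.∣0
    go (suc k) {x ∷ xs} len u closed equiv =
      subst (suc n ℕ∣.∣_) (sym |xs|)
        (ℕ∣.∣m∣n⇒∣m+n ℕ∣.∣-refl
          (go k (s≤s⁻¹ (ℕ.≤-trans rest<xs len)) (Unique.filter⁺ ∉? u) closed′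
              (λ y∈ → equiv (proj₁ (∈-filter⁻ ∉? y∈)))))
      where
      here! = here refl
      ∉? = λ y → ¬? (any? (y ≟_) (orb x))
      rest = filter ∉? (x ∷ xs)
      |xs| : length (x ∷ xs) ≡ suc n ℕ.+ length rest
      |xs| = trans
        (↭-length (unique-remove ∉? (orb x) u (proj₁ (closed here!)) (proj₂ (closed here!))
           (λ p ¬p → ¬p p) (λ {y} _ → decidable-stable (any? (y ≟_) (orb x)))))
        (trans (length-++ (orb x)) (cong (ℕ._+ length rest) (|orb| x)))
      rest<xs : length rest < length (x ∷ xs)
      rest<xs = subst (length rest <_) (sym |xs|) (ℕ.m<n+m _ (s≤s z≤n))
      closed′ : ∀ {y} → y ∈ rest → Unique (orb y) × orb y ⊆ rest
      closed′ {y} y∈ with ∈-filter⁻ ∉? {xs = x ∷ xs} y∈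
      -- If some w in `orb y` lay in `orb x`, then y, a member of `orb w`, would lie in `orb x` too.
      ... | y∈xs , y∉orb = proj₁ (closed y∈xs) , λ {w} w∈orb →
        ∈-filter⁺ ∉? (proj₂ (closed y∈xs) w∈orb) λ w∈orbx →
          y∉orb (proj₂ (equiv here! w∈orbx) (proj₁ (equiv y∈xs w∈orb)))

  involution⇒2∣length : (σ : A → A) {xs : List A} → Unique xs →
    (∀ {x} → x ∈ xs → σ x ∈ xs) →
    (∀ {x} → x ∈ xs → σ (σ x) ≡ x) →
    (∀ {x} → x ∈ xs → σ x ≢ x) →
    2 ℕ∣.∣ length xs
  involution⇒2∣length σ u closed invol free =
    orbits⇒∣length 1 (λ x → x ∷ σ x ∷ []) (λ _ → refl) u
      (λ x∈ → ((free x∈ ∘ sym) ∷ []) ∷ [] ∷ [] ,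
        λ { (here refl) → x∈ ; (there (here refl)) → closed x∈ })
      λ { x∈ (here refl) → here refl , λ p → p
        ; x∈ (there (here refl)) → there (here (sym (invol x∈))) ,
            λ { (here refl) → there (here refl)
              ; (there (here refl)) → here (invol x∈) } }

  -- The absence of fixed points already makes x, σx, σ²x distinct: x = σ²x would give σx = σ³x = x.
  rotation⇒3∣length : (σ : A → A) {xs : List A} → Unique xs →
    (∀ {x} → x ∈ xs → σ x ∈ xs) →
    (∀ {x} → x ∈ xs → σ (σ (σ x)) ≡ x) →
    (∀ {x} → x ∈ xs → σ x ≢ x) →
    3 ℕ∣.∣ length xs
  rotation⇒3∣length σ {xs} u closed cubed free =
    orbits⇒∣length 2 (λ x → x ∷ σ x ∷ σ (σ x) ∷ []) (λ _ → refl) u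
      (λ x∈ → ((free x∈ ∘ sym) ∷ (λ e → free x∈ (trans (cong σ e) (cubed x∈))) ∷ [])
              ∷ ((free (closed x∈) ∘ sym) ∷ []) ∷ [] ∷ [] ,
        λ { (here refl) → x∈ ; (there (here refl)) → closed x∈
          ; (there (there (here refl))) → closed (closed x∈) })
      λ { x∈ (here refl) → here refl , λ p → p
        ; x∈ (there (here refl)) → there (there (here (sym (cubed x∈)))) ,
            λ { (here refl) → there (here refl)
              ; (there (here refl)) → there (there (here refl))
              ; (there (there (here refl))) → here (cubed x∈) }
        ; x∈ (there (there (here refl))) → there (here (sym (cubed x∈))) ,
            λ { (here refl) → there (there (here refl))
              ; (there (here refl)) → here (cubed x∈)
              ; (there (there (here refl))) → there (here (cong σ (cubed x∈))) } }

-- Sums and products over lists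

module Fold {M : Set} {_∙_ : M → M → M} {ε : M} (isCM : IsCommutativeMonoid _≡_ _∙_ ε) where
  open IsCommutativeMonoid isCM using (assoc; comm; identityʳ)

  fold : (A → M) → List A → M
  fold f = foldr (λ x acc → f x ∙ acc) ε

  fold-↭ : (f : A → M) {xs ys : List A} → xs ↭ ys → fold f xs ≡ fold f ys
  fold-↭ f ↭.refl = refl
  fold-↭ f (prep x p) = cong (f x ∙_) (fold-↭ f p)
  fold-↭ f {_ ∷ _ ∷ xs} {_ ∷ _ ∷ ys} (swap x y p) = begin
    f x ∙ (f y ∙ fold f xs) ≡⟨ assoc _ _ _ ⟨
    (f x ∙ f y) ∙ fold f xs ≡⟨ cong₂ _∙_ (comm _ _) (fold-↭ f p) ⟩
    (f y ∙ f x) ∙ fold f ys ≡⟨ assoc _ _ _ ⟩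
    f y ∙ (f x ∙ fold f ys) ∎
  fold-↭ f (↭.trans p q) = trans (fold-↭ f p) (fold-↭ f q)

  fold-map : (f : B → M) (g : A → B) (xs : List A) → fold f (map g xs) ≡ fold (f ∘ g) xs
  fold-map f g [] = refl
  fold-map f g (x ∷ xs) = cong (f (g x) ∙_) (fold-map f g xs)

  fold-cong : {f g : A → M} (xs : List A) → (∀ {x} → x ∈ xs → f x ≡ g x) → fold f xs ≡ fold g xs
  fold-cong [] _ = refl
  fold-cong (x ∷ xs) f≗g = cong₂ _∙_ (f≗g (here refl)) (fold-cong xs (f≗g ∘ there))

  fold-∙ : (f g : A → M) (xs : List A) → fold (λ x → f x ∙ g x) xs ≡ fold f xs ∙ fold g xs
  fold-∙ f g [] = sym (identityʳ ε)
  fold-∙ f g (x ∷ xs) = begin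
    (f x ∙ g x) ∙ fold (λ y → f y ∙ g y) xs ≡⟨ cong ((f x ∙ g x) ∙_) (fold-∙ f g xs) ⟩
    (f x ∙ g x) ∙ (fold f xs ∙ fold g xs)   ≡⟨ assoc _ _ _ ⟩
    f x ∙ (g x ∙ (fold f xs ∙ fold g xs))   ≡⟨ cong (f x ∙_) (assoc _ _ _) ⟨
    f x ∙ ((g x ∙ fold f xs) ∙ fold g xs)   ≡⟨ cong (λ t → f x ∙ (t ∙ fold g xs)) (comm _ _) ⟩
    f x ∙ ((fold f xs ∙ g x) ∙ fold g xs)   ≡⟨ cong (f x ∙_) (assoc _ _ _) ⟩
    f x ∙ (fold f xs ∙ (g x ∙ fold g xs))   ≡⟨ assoc _ _ _ ⟨
    (f x ∙ fold f xs) ∙ (g x ∙ fold g xs)   ∎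

length-filter-map : {P : B → Set} (P? : Decidable P) (f : A → B) (xs : List A) →
                    length (filter P? (map f xs)) ≡ length (filter (P? ∘ f) xs)
length-filter-map P? f [] = refl
length-filter-map P? f (x ∷ xs) with P? (f x)
... | yes _ = cong suc (length-filter-map P? f xs)
... | no  _ = length-filter-map P? f xs

length-filter-cartesianProduct : {P : A × B → Set} (P? : Decidable P) (xs : List A) (ys : List B) →
  length (filter P? (cartesianProduct xs ys)) ≡
  foldr (λ x acc → length (filter (λ y → P? (x , y)) ys) ℕ.+ acc) 0 xs
length-filter-cartesianProduct P? [] ys = refl
length-filter-cartesianProduct P? (x ∷ xs) ys = begin
  length (filter P? (map (x ,_) ys ++ cartesianProduct xs ys))
    ≡⟨ cong length (filter-++ P? (map (x ,_) ys) _) ⟩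
  length (filter P? (map (x ,_) ys) ++ filter P? (cartesianProduct xs ys))
    ≡⟨ length-++ (filter P? (map (x ,_) ys)) ⟩
  length (filter P? (map (x ,_) ys)) ℕ.+ length (filter P? (cartesianProduct xs ys))
    ≡⟨ cong₂ ℕ._+_ (length-filter-map P? (x ,_) ys) (length-filter-cartesianProduct P? xs ys) ⟩
  _ ∎

-- Finite fields of characteristic two

module FieldTheory {m : ℕ} (F : FiniteField m) where
  open FiniteField F
  open IsCommutativeRing isCommutativeRing
    using (+-assoc; +-comm; +-identityˡ; +-identityʳ; -‿inverseʳ;
           *-assoc; *-comm; *-identityˡ; *-identityʳ; distribʳ; zeroˡ; zeroʳ;
           +-isCommutativeMonoid; *-isCommutativeMonoid)

  module Sum = Fold +-isCommutativeMonoid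
  module Prod = Fold *-isCommutativeMonoid

  commutativeRing : CommutativeRing _ _
  commutativeRing = record { isCommutativeRing = isCommutativeRing }

  open Algebra.Properties.Ring (CommutativeRing.ring commutativeRing)
    using (+-cancelˡ; +-cancelʳ; -0#≈0#)

  *-cancelˡ : ∀ {x y z} → x ≢ 0# → x * y ≡ x * z → y ≡ z
  *-cancelˡ {x} {y} {z} x≢0 xy≡xz = begin
    y               ≡⟨ drop y ⟨
    inv x * (x * y) ≡⟨ cong (inv x *_) xy≡xz ⟩
    inv x * (x * z) ≡⟨ drop z ⟩
    z               ∎
    where
    drop : ∀ w → inv x * (x * w) ≡ w
    drop w = begin
      inv x * (x * w) ≡⟨ *-assoc _ _ _ ⟨
      inv x * x * w   ≡⟨ cong (_* w) (trans (*-comm _ _) (inv-r x x≢0)) ⟩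
      1# * w          ≡⟨ *-identityˡ w ⟩
      w               ∎

  *-integral : ∀ {x y} → x * y ≡ 0# → x ≢ 0# → y ≡ 0#
  *-integral xy≡0 x≢0 = *-cancelˡ x≢0 (trans xy≡0 (sym (zeroʳ _)))

  *-nonzero : ∀ {x y} → x ≢ 0# → y ≢ 0# → x * y ≢ 0#
  *-nonzero x≢0 y≢0 xy≡0 = y≢0 (*-integral xy≡0 x≢0)

  invertible⇒nonzero : ∀ {x y} → x * y ≡ 1# → x ≢ 0#
  invertible⇒nonzero {y = y} xy≡1 refl = 0≢1 (trans (sym (zeroˡ y)) xy≡1)

  inv-unique : ∀ {x y} → x * y ≡ 1# → inv x ≡ y
  inv-unique {x} xy≡1 = *-cancelˡ x≢0 (trans (inv-r x x≢0) (sym xy≡1))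
    where x≢0 = invertible⇒nonzero xy≡1

  inv-nonzero : ∀ {x} → x ≢ 0# → inv x ≢ 0#
  inv-nonzero {x} x≢0 = invertible⇒nonzero (trans (*-comm _ _) (inv-r x x≢0))

  nonzero : List Carrier
  nonzero = filter (λ x → ¬? (x ≟ 0#)) elements

  ∈-nonzero⁺ : ∀ {x} → x ≢ 0# → x ∈ nonzero
  ∈-nonzero⁺ {x} = ∈-filter⁺ _ (complete x)

  ∈-nonzero⁻ : ∀ {x} → x ∈ nonzero → x ≢ 0#
  ∈-nonzero⁻ = proj₂ ∘ ∈-filter⁻ (λ x → ¬? (x ≟ 0#)) {xs = elements}

  nonzero-unique : Unique nonzero
  nonzero-unique = Unique.filter⁺ _ unique

  elements↭ : elements ↭ 0# ∷ nonzero
  elements↭ = unique-remove (λ x → ¬? (x ≟ 0#)) (0# ∷ []) unique ([] ∷ []) (λ _ → complete _)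
    (λ { (here refl) 0≢0 → 0≢0 refl }) λ {x} _ → here ∘ decidable-stable (x ≟ 0#)

  card-nonzero : suc (length nonzero) ≡ 2 ^ m
  card-nonzero = trans (sym (↭-length elements↭)) card

  ι : ℕ → Carrier
  ι zero    = 0#
  ι (suc n) = 1# + ι n

  ι-+ : ∀ k n → ι (k ℕ.+ n) ≡ ι k + ι n
  ι-+ zero    n = sym (+-identityˡ _)
  ι-+ (suc k) n = trans (cong (1# +_) (ι-+ k n)) (sym (+-assoc _ _ _))

  sum-const-1 : (xs : List Carrier) → Sum.fold (const 1#) xs ≡ ι (length xs)
  sum-const-1 []       = refl
  sum-const-1 (x ∷ xs) = cong (1# +_) (sum-const-1 xs)

  -- Translation by 1 permutes the field, so the sum of all elements equals itself plus 2^m.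
  ι-card≡0 : ι (2 ^ m) ≡ 0#
  ι-card≡0 = +-cancelˡ (Sum.fold id elements) _ _ (begin
    Sum.fold id elements + ι (2 ^ m)                  ≡⟨ cong (λ n → Sum.fold id elements + ι n) card ⟨
    Sum.fold id elements + ι (length elements)        ≡⟨ cong (Sum.fold id elements +_) (sum-const-1 elements) ⟨
    Sum.fold id elements + Sum.fold (const 1#) elements ≡⟨ Sum.fold-∙ id (const 1#) elements ⟨
    Sum.fold (_+ 1#) elements                         ≡⟨ Sum.fold-map id (_+ 1#) elements ⟨
    Sum.fold id (map (_+ 1#) elements)                ≡⟨ Sum.fold-↭ id (injection⇒↭ (_+ 1#) unique (λ _ → complete _) (λ _ _ → +-cancelʳ _ _ _)) ⟩
    Sum.fold id elements                              ≡⟨ +-identityʳ _ ⟨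
    Sum.fold id elements + 0#                         ∎)

  -- `ι (2 ^ k)` is the k-th power of 1 + 1, and a field has no nilpotents except 0; the exponent 0
  -- would force 1 = 0.
  1+1≡0 : 1# + 1# ≡ 0#
  1+1≡0 = go m ι-card≡0
    where
    go : ∀ k → ι (2 ^ k) ≡ 0# → 1# + 1# ≡ 0#
    go zero    1+0≡0 = contradiction (trans (sym 1+0≡0) (+-identityʳ 1#)) 0≢1
    go (suc k) eq with (1# + 1#) ≟ 0#
    ... | yes 2≡0 = 2≡0
    ... | no  2≢0 = go k (*-integral (begin
      (1# + 1#) * ι (2 ^ k)             ≡⟨ distribʳ _ _ _ ⟩
      1# * ι (2 ^ k) + 1# * ι (2 ^ k)   ≡⟨ cong₂ _+_ (*-identityˡ _) (*-identityˡ _) ⟩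
      ι (2 ^ k) + ι (2 ^ k)             ≡⟨ ι-+ (2 ^ k) (2 ^ k) ⟨
      ι (2 ^ k ℕ.+ 2 ^ k)               ≡⟨ cong (λ n → ι (2 ^ k ℕ.+ n)) (ℕ.+-identityʳ (2 ^ k)) ⟨
      ι (2 ^ suc k)                     ≡⟨ eq ⟩
      0#                                ∎) 2≢0)

  -- The coefficients form 𝔽₂, so the solver decides identities in characteristic two.
  private
    𝔽₂⟶F : CommutativeRing.rawRing xor-∧-commutativeRing -Raw-AlmostCommutative⟶ fromCommutativeRing commutativeRing
    𝔽₂⟶F = record
      { ⟦_⟧    = λ { true → 1# ; false → 0# }
      ; +-homo = λ { true true → sym 1+1≡0 ; true false → sym (+-identityʳ _) ; false y → sym (+-identityˡ _) }
      ; *-homo = λ { true y → sym (*-identityˡ _) ; false y → sym (zeroˡ _) }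
      ; -‿homo = λ { true → +-cancelˡ 1# _ _ (trans 1+1≡0 (sym (-‿inverseʳ 1#))) ; false → sym -0#≈0# }
      ; 0-homo = refl
      ; 1-homo = refl
      }

    _≟₂_ : WeaklyDecidable (Induced-equivalence 𝔽₂⟶F)
    true  ≟₂ true  = just refl
    false ≟₂ false = just refl
    _     ≟₂ _     = nothing

  open Algebra.Solver.Ring (CommutativeRing.rawRing xor-∧-commutativeRing)
    (fromCommutativeRing commutativeRing) 𝔽₂⟶F _≟₂_ public
    using (solve; con; _:+_; _:*_; _:=_)

  x+x≡0 : ∀ x → x + x ≡ 0#
  x+x≡0 = solve 1 (λ x → x :+ x := con false) refl

  x+y≡0⇒x≡y : ∀ {x y} → x + y ≡ 0# → x ≡ y
  x+y≡0⇒x≡y {x} {y} eq = +-cancelʳ y _ _ (trans eq (sym (x+x≡0 y)))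

  x≢y⇒x+y≢0 : ∀ {x y} → x ≢ y → x + y ≢ 0#
  x≢y⇒x+y≢0 x≢y = x≢y ∘ x+y≡0⇒x≡y

  square-injective : ∀ {x y} → x * x ≡ y * y → x ≡ y
  square-injective {x} {y} x²≡y² with (x + y) ≟ 0#
  ... | yes x+y≡0 = x+y≡0⇒x≡y x+y≡0
  ... | no  x+y≢0 = x+y≡0⇒x≡y (*-integral (begin
    (x + y) * (x + y) ≡⟨ solve 2 (λ x y → (x :+ y) :* (x :+ y) := x :* x :+ y :* y) refl x y ⟩
    x * x + y * y     ≡⟨ cong (_+ y * y) x²≡y² ⟩
    y * y + y * y     ≡⟨ x+x≡0 _ ⟩
    0#                ∎) x+y≢0)

  -- Squaring is injective, hence surjective on a finite field.
  sqrt : ∀ x → ∃ λ r → r * r ≡ x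
  sqrt x with ∈-map⁻ (λ r → r * r) (∈-resp-↭ (↭-sym squares↭) (complete x))
    where
    squares↭ : map (λ r → r * r) elements ↭ elements
    squares↭ = injection⇒↭ (λ r → r * r) unique (λ _ → complete _) (λ _ _ → square-injective)
  ... | r , _ , x≡r² = r , sym x≡r²

  pow-+ : ∀ x k n → pow x (k ℕ.+ n) ≡ pow x k * pow x n
  pow-+ x zero    n = sym (*-identityˡ _)
  pow-+ x (suc k) n = trans (cong (x *_) (pow-+ x k n)) (sym (*-assoc _ _ _))

  pow-nonzero : ∀ {x} → x ≢ 0# → ∀ k → pow x k ≢ 0#
  pow-nonzero x≢0 zero    = 0≢1 ∘ sym
  pow-nonzero x≢0 (suc k) = *-nonzero x≢0 (pow-nonzero x≢0 k)

  prod-nonzero : {xs : List Carrier} → All (_≢ 0#) xs → Prod.fold id xs ≢ 0#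
  prod-nonzero []       = 0≢1 ∘ sym
  prod-nonzero (p ∷ ps) = *-nonzero p (prod-nonzero ps)

  prod-const : ∀ x (xs : List Carrier) → Prod.fold (const x) xs ≡ pow x (length xs)
  prod-const x []       = refl
  prod-const x (_ ∷ xs) = cong (x *_) (prod-const x xs)

  -- Multiplication by x permutes the nonzero elements, so it preserves their product.
  fermat-nonzero : ∀ {x} → x ≢ 0# → pow x (length nonzero) ≡ 1#
  fermat-nonzero {x} x≢0 = *-cancelˡ (prod-nonzero (All.tabulate ∈-nonzero⁻)) (begin
    Π * pow x (length nonzero)            ≡⟨ *-comm _ _ ⟩
    pow x (length nonzero) * Π            ≡⟨ cong (_* Π) (prod-const x nonzero) ⟨
    Prod.fold (const x) nonzero * Π       ≡⟨ Prod.fold-∙ (const x) id nonzero ⟨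
    Prod.fold (x *_) nonzero              ≡⟨ Prod.fold-map id (x *_) nonzero ⟨
    Prod.fold id (map (x *_) nonzero)     ≡⟨ Prod.fold-↭ id (injection⇒↭ (x *_) nonzero-unique
                                               (λ p → ∈-nonzero⁺ (*-nonzero x≢0 (∈-nonzero⁻ p)))
                                               (λ _ _ → *-cancelˡ x≢0)) ⟩
    Π                                     ≡⟨ *-identityʳ _ ⟨
    Π * 1#                                ∎)
    where Π = Prod.fold id nonzero

  fermat : ∀ x → pow x (2 ^ m) ≡ x
  fermat x with x ≟ 0#
  -- `card-nonzero` exhibits the exponent as a successor, which exposes a factor 0.
  ... | yes refl = trans (cong (pow 0#) (sym card-nonzero)) (zeroˡ _)
  ... | no  x≢0  = trans (cong (pow x) (sym card-nonzero))
                         (trans (cong (x *_) (fermat-nonzero x≢0)) (*-identityʳ x))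

  -- Frobenius powers and the absolute trace

  frob : ℕ → Carrier → Carrier
  frob i x = pow x (2 ^ i)

  frob-suc : ∀ i x → frob (suc i) x ≡ frob i x * frob i x
  frob-suc i x = trans (pow-+ x (2 ^ i) _) (cong (λ n → frob i x * pow x n) (ℕ.+-identityʳ (2 ^ i)))

  frob-+ : ∀ i x y → frob i (x + y) ≡ frob i x + frob i y
  frob-+ zero x y = solve 2 (λ x y → (x :+ y) :* con true := x :* con true :+ y :* con true) refl x y
  frob-+ (suc i) x y = begin
    frob (suc i) (x + y)                              ≡⟨ frob-suc i _ ⟩
    frob i (x + y) * frob i (x + y)                   ≡⟨ cong (λ t → t * t) (frob-+ i x y) ⟩
    (frob i x + frob i y) * (frob i x + frob i y)     ≡⟨ solve 2 (λ x y → (x :+ y) :* (x :+ y) := x :* x :+ y :* y) refl _ _ ⟩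
    frob i x * frob i x + frob i y * frob i y         ≡⟨ cong₂ _+_ (frob-suc i x) (frob-suc i y) ⟨
    frob (suc i) x + frob (suc i) y                   ∎

  frob-square : ∀ i x → frob i (x * x) ≡ frob i x * frob i x
  frob-square zero x = solve 1 (λ x → x :* x :* con true := x :* con true :* (x :* con true)) refl x
  frob-square (suc i) x = begin
    frob (suc i) (x * x)                  ≡⟨ frob-suc i _ ⟩
    frob i (x * x) * frob i (x * x)       ≡⟨ cong (λ t → t * t) (frob-square i x) ⟩
    frob i x * frob i x * (frob i x * frob i x) ≡⟨ cong (λ t → t * t) (frob-suc i x) ⟨
    frob (suc i) x * frob (suc i) x       ∎

  -- The trace truncated to k terms. `Tr` is the case k = m, but m is tied to the field, so
  -- inductions need a free length.
  partialTr : ℕ → Carrier → Carrier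
  partialTr k x = Sum.fold (λ i → frob i x) (upTo k)

  partialTr-suc : ∀ k x → partialTr (suc k) x ≡ partialTr k x + frob k x
  partialTr-suc k x = snoc id k
    where
    -- The list of exponents unfolds at its front; a general `g` lets the induction reach the last
    -- term.
    snoc : ∀ g k → Sum.fold (λ i → frob i x) (applyUpTo g (suc k)) ≡
                   Sum.fold (λ i → frob i x) (applyUpTo g k) + frob (g k) x
    snoc g zero    = +-comm _ _
    snoc g (suc k) = trans (cong (frob (g 0) x +_) (snoc (g ∘ suc) k)) (sym (+-assoc _ _ _))

  Tr-+ : ∀ x y → Tr (x + y) ≡ Tr x + Tr y
  Tr-+ x y = trans (Sum.fold-cong (upTo m) (λ {i} _ → frob-+ i x y)) (Sum.fold-∙ _ _ (upTo m))

  partialTr-square : ∀ k x → partialTr k (x * x) ≡ partialTr k x * partialTr k x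
  partialTr-square zero x = sym (zeroˡ 0#)
  partialTr-square (suc k) x = begin
    partialTr (suc k) (x * x)                               ≡⟨ partialTr-suc k _ ⟩
    partialTr k (x * x) + frob k (x * x)                    ≡⟨ cong₂ _+_ (partialTr-square k x) (frob-square k x) ⟩
    partialTr k x * partialTr k x + frob k x * frob k x     ≡⟨ solve 2 (λ x y → x :* x :+ y :* y := (x :+ y) :* (x :+ y)) refl _ _ ⟩
    (partialTr k x + frob k x) * (partialTr k x + frob k x) ≡⟨ cong (λ t → t * t) (partialTr-suc k x) ⟨
    partialTr (suc k) x * partialTr (suc k) x               ∎

  -- Squaring shifts the exponents by one, so all terms except the two outer ones cancel.
  partialTr-telescope : ∀ k x → partialTr k (x * x) + partialTr k x ≡ x + frob k x
  partialTr-telescope zero x = solve 1 (λ x → con false :+ con false := x :+ x :* con true) refl x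
  partialTr-telescope (suc k) x = begin
    partialTr (suc k) (x * x) + partialTr (suc k) x
      ≡⟨ cong₂ _+_ (partialTr-suc k _) (partialTr-suc k x) ⟩
    partialTr k (x * x) + frob k (x * x) + (partialTr k x + frob k x)
      ≡⟨ solve 4 (λ a b c d → a :+ b :+ (c :+ d) := a :+ c :+ (b :+ d)) refl _ _ _ _ ⟩
    partialTr k (x * x) + partialTr k x + (frob k (x * x) + frob k x)
      ≡⟨ cong₂ _+_ (partialTr-telescope k x) (cong (_+ frob k x) (trans (frob-square k x) (sym (frob-suc k x)))) ⟩
    x + frob k x + (frob (suc k) x + frob k x)
      ≡⟨ solve 3 (λ x y z → x :+ y :+ (z :+ y) := x :+ z) refl _ _ _ ⟩
    x + frob (suc k) x ∎

  Tr-square : ∀ x → Tr (x * x) ≡ Tr x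
  Tr-square x = x+y≡0⇒x≡y (begin
    Tr (x * x) + Tr x ≡⟨ partialTr-telescope m x ⟩
    x + frob m x      ≡⟨ cong (x +_) (fermat x) ⟩
    x + x             ≡⟨ x+x≡0 x ⟩
    0#                ∎)

  -- Tr(x)² = Tr(x²) = Tr(x), and the only nonzero idempotent of a field is 1.
  Tr-∈𝔽₂ : ∀ x → Tr x ≢ 0# → Tr x ≡ 1#
  Tr-∈𝔽₂ x t≢0 = *-cancelˡ t≢0 (trans (trans (sym (partialTr-square m x)) (Tr-square x)) (sym (*-identityʳ _)))

  Tr-0 : Tr 0# ≡ 0#
  Tr-0 = +-cancelˡ (Tr 0#) _ _ (trans (sym (Tr-+ 0# 0#)) (trans (cong Tr (+-identityˡ 0#)) (sym (+-identityʳ _))))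

  Tr-artinSchreier : ∀ z → Tr (z * z + z) ≡ 0#
  Tr-artinSchreier z = trans (Tr-+ _ _) (trans (cong (_+ Tr z) (Tr-square z)) (x+x≡0 _))

  Tr-1-even : m % 2 ≡ 0 → Tr 1# ≡ 0#
  Tr-1-even = go m
    where
    pow-1 : ∀ n → pow 1# n ≡ 1#
    pow-1 zero    = refl
    pow-1 (suc n) = trans (*-identityˡ _) (pow-1 n)
    go : ∀ k → k % 2 ≡ 0 → partialTr k 1# ≡ 0#
    go zero          _    = refl
    go (suc (suc k)) even = begin
      partialTr (2 ℕ.+ k) 1#                      ≡⟨ partialTr-suc (suc k) 1# ⟩
      partialTr (suc k) 1# + frob (suc k) 1#      ≡⟨ cong₂ _+_ (partialTr-suc k 1#) (pow-1 (2 ^ suc k)) ⟩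
      partialTr k 1# + frob k 1# + 1#             ≡⟨ cong₂ (λ s t → s + t + 1#) (go k even) (pow-1 (2 ^ k)) ⟩
      0# + 1# + 1#                                ≡⟨ solve 0 (con false :+ con true :+ con true := con false) refl ⟩
      0#                                          ∎

  -- Polynomial functions in Horner form

  Monic : ℕ → (Carrier → Carrier) → Set
  Monic zero    f = ∀ x → f x ≡ 1#
  Monic (suc n) f = ∃ λ c → ∃ λ g → Monic n g × (∀ x → f x ≡ c + x * g x)

  Degree< : ℕ → (Carrier → Carrier) → Set
  Degree< zero    f = ∀ x → f x ≡ 0#
  Degree< (suc n) f = ∃ λ c → ∃ λ g → Degree< n g × (∀ x → f x ≡ c + x * g x)

  -- Synthetic division by X - r, where minus is plus: if h = (x + r)k + h(r), then c + xh has
  -- quotient h(r) + xk.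
  monic-divide : ∀ n {f} r → Monic (suc n) f → ∃ λ g → Monic n g × (∀ x → f x ≡ (x + r) * g x + f r)
  monic-divide zero {f} r (c , h , h≡1 , f≡) = const 1# , (λ _ → refl) , λ x → begin
    f x                        ≡⟨ f≡1 x ⟩
    c + x * 1#                 ≡⟨ solve 3 (λ c x r → c :+ x :* con true := (x :+ r) :* con true :+ (c :+ r :* con true)) refl c x r ⟩
    (x + r) * 1# + (c + r * 1#) ≡⟨ cong ((x + r) * 1# +_) (f≡1 r) ⟨
    (x + r) * 1# + f r         ∎
    where
    f≡1 : ∀ x → f x ≡ c + x * 1#
    f≡1 x = trans (f≡ x) (cong (λ t → c + x * t) (h≡1 x))
  monic-divide (suc n) {f} r (c , h , h-monic , f≡) with monic-divide n r h-monic
  ... | k , k-monic , h≡ = (λ x → h r + x * k x) , (h r , k , k-monic , λ _ → refl) , λ x → begin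
    f x                                     ≡⟨ f≡ x ⟩
    c + x * h x                             ≡⟨ cong (λ t → c + x * t) (h≡ x) ⟩
    c + x * ((x + r) * k x + h r)           ≡⟨ solve 5 (λ c x r y z → c :+ x :* ((x :+ r) :* y :+ z) :=
                                                 (x :+ r) :* (z :+ x :* y) :+ (c :+ r :* z)) refl c x r (k x) (h r) ⟩
    (x + r) * (h r + x * k x) + (c + r * h r) ≡⟨ cong ((x + r) * (h r + x * k x) +_) (f≡ r) ⟨
    (x + r) * (h r + x * k x) + f r         ∎

  -- After division at one root r, every other root survives in the quotient because its factor x +
  -- r is nonzero.
  monic-roots : ∀ n {f} → Monic n f → {xs : List Carrier} → Unique xs → All (λ x → f x ≡ 0#) xs → length xs ≤ n
  monic-roots _ _ [] [] = z≤n
  monic-roots zero f≡1 (_ ∷ _) (fx≡0 ∷ _) = contradiction (trans (sym fx≡0) (f≡1 _)) 0≢1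
  monic-roots (suc n) {f} f-monic {r ∷ xs} (r∉xs ∷ u) (fr≡0 ∷ roots) with monic-divide n r f-monic
  ... | g , g-monic , f≡ = s≤s (monic-roots n g-monic u (All.tabulate λ {x} x∈xs →
    *-integral (begin
      (x + r) * g x       ≡⟨ +-identityʳ _ ⟨
      (x + r) * g x + 0#  ≡⟨ cong ((x + r) * g x +_) fr≡0 ⟨
      (x + r) * g x + f r ≡⟨ f≡ x ⟨
      f x                 ≡⟨ All.lookup roots x∈xs ⟩
      0#                  ∎) (x≢y⇒x+y≢0 (All.lookup r∉xs x∈xs ∘ sym))))

  monic-pow : ∀ n → Monic n (λ x → pow x n)
  monic-pow zero    _ = refl
  monic-pow (suc n) = 0# , _ , monic-pow n , λ x → sym (+-identityˡ _)

  monic-+ : ∀ n {f g h} → Degree< n f → Monic n g → (∀ x → h x ≡ f x + g x) → Monic n h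
  monic-+ zero f≡0 g≡1 h≡ x = trans (h≡ x) (trans (cong₂ _+_ (f≡0 x) (g≡1 x)) (+-identityˡ 1#))
  monic-+ (suc n) {f} {g} {h} (c , f′ , f′-deg , f≡) (d , g′ , g′-monic , g≡) h≡ =
    c + d , _ , monic-+ n f′-deg g′-monic (λ _ → refl) , λ x → begin
      h x                               ≡⟨ h≡ x ⟩
      f x + g x                         ≡⟨ cong₂ _+_ (f≡ x) (g≡ x) ⟩
      c + x * f′ x + (d + x * g′ x)     ≡⟨ solve 5 (λ c x y d z → c :+ x :* y :+ (d :+ x :* z) :=
                                             c :+ d :+ x :* (y :+ z)) refl c x (f′ x) d (g′ x) ⟩
      c + d + x * (f′ x + g′ x)         ∎

  degree<-0 : ∀ n {f} → (∀ x → f x ≡ 0#) → Degree< n f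
  degree<-0 zero    f≡0 = f≡0
  degree<-0 (suc n) f≡0 = 0# , const 0# , degree<-0 n (λ _ → refl) ,
    λ x → trans (f≡0 x) (solve 1 (λ x → con false := con false :+ x :* con false) refl x)

  monic⇒degree< : ∀ {k n f} → k < n → Monic k f → Degree< n f
  monic⇒degree< {zero} {suc n} _ f≡1 = 1# , const 0# , degree<-0 n (λ _ → refl) ,
    λ x → trans (f≡1 x) (solve 1 (λ x → con true := con true :+ x :* con false) refl x)
  monic⇒degree< {suc k} (s≤s k<n) (c , g , g-monic , f≡) = c , g , monic⇒degree< k<n g-monic , f≡

  -- The newest term x^(2^k) dominates the shorter sum, whose degree is at most 2^(k-1) when that
  -- sum is nonempty; hence the mutual induction.
  partialTr-monic : ∀ k → Monic (2 ^ k) (partialTr (suc k))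
  partialTr-degree< : ∀ k → Degree< (2 ^ k) (partialTr k)
  partialTr-monic k = monic-+ (2 ^ k) (partialTr-degree< k) (monic-pow (2 ^ k)) (partialTr-suc k)
  partialTr-degree< zero    = degree<-0 1 (λ _ → refl)
  partialTr-degree< (suc k) = monic⇒degree< (ℕ.^-monoʳ-< 2 (s≤s (s≤s z≤n)) (ℕ.n<1+n k)) (partialTr-monic k)

  -- The trace is a monic polynomial of degree 2^(m-1), too small to vanish at all 2^m elements.
  Tr-nonzero : 1 ≤ m → ∃ λ θ → Tr θ ≢ 0#
  Tr-nonzero 1≤m = go m refl 1≤m
    where
    go : ∀ k → k ≡ m → 1 ≤ k → ∃ λ θ → Tr θ ≢ 0#
    go (suc k) refl _ with All.all? (λ x → Tr x ≟ 0#) elements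
    ... | yes all≡0 = contradiction
      (subst (_≤ 2 ^ k) card (monic-roots (2 ^ k) (partialTr-monic k) unique all≡0))
      (ℕ.<⇒≱ (ℕ.^-monoʳ-< 2 (s≤s (s≤s z≤n)) (ℕ.n<1+n k)))
    ... | no ¬all≡0 with find (¬All⇒Any¬ (λ x → Tr x ≟ 0#) elements ¬all≡0)
    ...   | θ , _ , Trθ≢0 = θ , Trθ≢0

  -- Hilbert 90 : the solution of z² + z = c is z = Σₖ partialTr k c · θ^(2^k).
  hilbert90 : ∀ c θ → Tr c ≡ 0# → Tr θ ≢ 0# → ∃ λ z → z * z + z ≡ c
  hilbert90 c θ Trc≡0 Trθ≢0 = z m , (begin
    z m * z m + z m                             ≡⟨ z-equation m ⟩
    c * (Tr θ * Tr θ) + Tr c * frob m θ         ≡⟨ cong₂ (λ s t → c * (s * s) + t * frob m θ) (Tr-∈𝔽₂ θ Trθ≢0) Trc≡0 ⟩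
    c * (1# * 1#) + 0# * frob m θ               ≡⟨ solve 2 (λ c t → c :* (con true :* con true) :+ con false :* t := c) refl c (frob m θ) ⟩
    c                                           ∎)
    where
    z : ℕ → Carrier
    z zero    = 0#
    z (suc k) = z k + partialTr k c * frob k θ
    -- At k = m the right side collapses to c, since Tr θ = 1 and Tr c = 0.
    z-equation : ∀ k → z k * z k + z k ≡ c * (partialTr k θ * partialTr k θ) + partialTr k c * frob k θ
    z-equation zero = solve 2 (λ c θ → con false :* con false :+ con false :=
      c :* (con false :* con false) :+ con false :* (θ :* con true)) refl c θ
    z-equation (suc k) = begin
      z (suc k) * z (suc k) + z (suc k)
        ≡⟨ solve 3 (λ z s f → (z :+ s :* f) :* (z :+ s :* f) :+ (z :+ s :* f) :=
             (z :* z :+ z) :+ (s :* s :* (f :* f) :+ s :* f)) refl (z k) S f ⟩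
      (z k * z k + z k) + (S * S * (f * f) + S * f)
        ≡⟨ cong₂ (λ t u → t + (u * (f * f) + S * f)) (z-equation k) S² ⟩
      c * (T * T) + S * f + ((c + (S + e)) * (f * f) + S * f)
        ≡⟨ solve 5 (λ c T S f e → c :* (T :* T) :+ S :* f :+ ((c :+ (S :+ e)) :* (f :* f) :+ S :* f) :=
             c :* ((T :+ f) :* (T :+ f)) :+ (S :+ e) :* (f :* f)) refl c T S f e ⟩
      c * ((T + f) * (T + f)) + (S + e) * (f * f)
        ≡⟨ cong₂ _+_ (cong (λ t → c * (t * t)) (partialTr-suc k θ)) (cong₂ _*_ (partialTr-suc k c) (frob-suc k θ)) ⟨
      c * (partialTr (suc k) θ * partialTr (suc k) θ) + partialTr (suc k) c * frob (suc k) θ ∎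
      where
      S = partialTr k c
      T = partialTr k θ
      f = frob k θ
      e = frob k c
      S² : S * S ≡ c + (S + e)
      S² = begin
        S * S                             ≡⟨ solve 2 (λ s t → s := s :+ t :+ t) refl (S * S) S ⟩
        S * S + S + S                     ≡⟨ cong (λ t → t + S + S) (partialTr-square k c) ⟨
        partialTr k (c * c) + S + S       ≡⟨ cong (_+ S) (partialTr-telescope k c) ⟩
        c + e + S                         ≡⟨ solve 3 (λ c e s → c :+ e :+ s := c :+ (s :+ e)) refl c e S ⟩
        c + (S + e)                       ∎

-- Kloosterman sums modulo four

module ΣN = Fold ℕ.+-0-isCommutativeMonoid
module ΣZ = Fold ℤ.+-0-isCommutativeMonoid

ΣN⇒ΣZ : {A : Set} (f : A → ℕ) (xs : List A) → ℤ.+ ΣN.fold f xs ≡ ΣZ.fold (λ x → ℤ.+ f x) xs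
ΣN⇒ΣZ f []       = refl
ΣN⇒ΣZ f (x ∷ xs) = trans (ℤ.pos-+ (f x) _) (cong (ℤ._+_ (ℤ.+ f x)) (ΣN⇒ΣZ f xs))

ΣZ-const-1 : {A : Set} (xs : List A) → ΣZ.fold (const (ℤ.+ 1)) xs ≡ ℤ.+ length xs
ΣZ-const-1 []       = refl
ΣZ-const-1 (x ∷ xs) = cong (ℤ._+_ (ℤ.+ 1)) (ΣZ-const-1 xs)

ΣZ-* : {A : Set} (c : ℤ) (f : A → ℤ) (xs : List A) → ΣZ.fold (λ x → c ℤ.* f x) xs ≡ c ℤ.* ΣZ.fold f xs
ΣZ-* c f []       = sym (ℤ.*-zeroʳ c)
ΣZ-* c f (x ∷ xs) = trans (cong (ℤ._+_ (c ℤ.* f x)) (ΣZ-* c f xs)) (sym (ℤ.*-distribˡ-+ c (f x) _))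

4∣2^ : ∀ k → 2 ≤ k → 4 ℕ∣.∣ 2 ^ k
4∣2^ (suc (suc k)) _ = ℕ∣.divides (2 ^ k) (trans (sym (ℕ.*-assoc 2 2 (2 ^ k))) (ℕ.*-comm 4 (2 ^ k)))
4∣2^ (suc zero) (s≤s ())

-- Modulo 4, l is -1 and 2n is 0, so k is -1, that is 3.
4∣l-2n-3 : ∀ {k l n} → k ≡ ℤ.+ l ℤ.- ℤ.+ 2 ℤ.* ℤ.+ n → 4 ℕ∣.∣ suc l → 2 ℕ∣.∣ n → (ℤ.+ 4) ℤ∣.∣ (k ℤ.- ℤ.+ 3)
4∣l-2n-3 {k} {l} k≡ (ℕ∣.divides q 1+l≡) (ℕ∣.divides n refl) = divides (ℤ.+ q ℤ.- ℤ.+ n ℤ.- ℤ.+ 1) (begin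
  k ℤ.- ℤ.+ 3
    ≡⟨ cong (ℤ._- ℤ.+ 3) k≡ ⟩
  ℤ.+ l ℤ.- ℤ.+ 2 ℤ.* ℤ.+ (n ℕ.* 2) ℤ.- ℤ.+ 3
    ≡⟨ ℤ-solve 2 (λ l n → l ⊖ ℤ-con (ℤ.+ 2) ⊗ n ⊖ ℤ-con (ℤ.+ 3) ⊜
         (ℤ-con (ℤ.+ 1) ⊕ l) ⊖ ℤ-con (ℤ.+ 2) ⊗ n ⊖ ℤ-con (ℤ.+ 4)) refl (ℤ.+ l) (ℤ.+ (n ℕ.* 2)) ⟩
  ℤ.+ suc l ℤ.- ℤ.+ 2 ℤ.* ℤ.+ (n ℕ.* 2) ℤ.- ℤ.+ 4
    ≡⟨ cong₂ (λ s t → s ℤ.- ℤ.+ 2 ℤ.* t ℤ.- ℤ.+ 4) (trans (cong ℤ.+_ 1+l≡) (ℤ.pos-* q 4)) (ℤ.pos-* n 2) ⟩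
  ℤ.+ q ℤ.* ℤ.+ 4 ℤ.- ℤ.+ 2 ℤ.* (ℤ.+ n ℤ.* ℤ.+ 2) ℤ.- ℤ.+ 4
    ≡⟨ ℤ-solve 2 (λ q n → q ⊗ ℤ-con (ℤ.+ 4) ⊖ ℤ-con (ℤ.+ 2) ⊗ (n ⊗ ℤ-con (ℤ.+ 2)) ⊖ ℤ-con (ℤ.+ 4) ⊜
         (q ⊖ n ⊖ ℤ-con (ℤ.+ 1)) ⊗ ℤ-con (ℤ.+ 4)) refl (ℤ.+ q) (ℤ.+ n) ⟩
  (ℤ.+ q ℤ.- ℤ.+ n ℤ.- ℤ.+ 1) ℤ.* ℤ.+ 4 ∎)

-- Trace signs and Artin-Schreier fibres

module Kloosterman {m : ℕ} (F : FiniteField m) where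
  open FiniteField F
  open FieldTheory F
  open IsCommutativeRing isCommutativeRing
    using (+-comm; +-identityˡ; +-identityʳ; *-comm)

  signTr-0 : ∀ {x} → Tr x ≡ 0# → signTr x ≡ ℤ.+ 1
  signTr-0 {x} eq with Tr x ≟ 0#
  ... | yes _ = refl
  ... | no ¬eq = contradiction eq ¬eq

  signTr-1 : ∀ {x} → Tr x ≢ 0# → signTr x ≡ ℤ.-[1+ 0 ]
  signTr-1 {x} ¬eq with Tr x ≟ 0#
  ... | yes eq = contradiction eq ¬eq
  ... | no  _ = refl

  signTr-+ : ∀ x y → signTr (x + y) ≡ signTr x ℤ.* signTr y
  signTr-+ x y = split (Tr x ≟ 0#) (Tr y ≟ 0#)
    where
    Tr-x+y : ∀ {s t} → Tr x ≡ s → Tr y ≡ t → Tr (x + y) ≡ s + t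
    Tr-x+y p q = trans (Tr-+ x y) (cong₂ _+_ p q)
    split : Dec (Tr x ≡ 0#) → Dec (Tr y ≡ 0#) → signTr (x + y) ≡ signTr x ℤ.* signTr y
    split (yes p) (yes q) = trans (signTr-0 (trans (Tr-x+y p q) (+-identityˡ 0#)))
      (sym (cong₂ ℤ._*_ (signTr-0 p) (signTr-0 q)))
    split (yes p) (no q) = trans
      (signTr-1 (λ e → q (trans (sym (+-identityˡ _)) (trans (sym (Tr-x+y p refl)) e))))
      (sym (cong₂ ℤ._*_ (signTr-0 p) (signTr-1 q)))
    split (no p) (yes q) = trans
      (signTr-1 (λ e → p (trans (sym (+-identityʳ _)) (trans (sym (Tr-x+y refl q)) e))))
      (sym (cong₂ ℤ._*_ (signTr-1 p) (signTr-0 q)))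
    split (no p) (no q) = trans
      (signTr-0 (trans (Tr-x+y (Tr-∈𝔽₂ x p) (Tr-∈𝔽₂ y q)) 1+1≡0))
      (sym (cong₂ ℤ._*_ (signTr-1 p) (signTr-1 q)))

  signTr-square : ∀ x → signTr x ℤ.* signTr x ≡ ℤ.+ 1
  signTr-square x = trans (sym (signTr-+ x x)) (signTr-0 (trans (cong Tr (x+x≡0 x)) Tr-0))

  signTr-artinSchreier : ∀ h x → signTr (h * h + h + x) ≡ signTr x
  signTr-artinSchreier h x = begin
    signTr (h * h + h + x)              ≡⟨ signTr-+ _ x ⟩
    signTr (h * h + h) ℤ.* signTr x     ≡⟨ cong (ℤ._* signTr x) (signTr-0 (Tr-artinSchreier h)) ⟩
    ℤ.+ 1 ℤ.* signTr x                  ≡⟨ ℤ.*-identityˡ _ ⟩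
    signTr x                            ∎

  artinSchreier-fibre : ∀ {w z} → w * w + w ≡ z * z + z → w ≡ z ⊎ w ≡ z + 1#
  artinSchreier-fibre {w} {z} eq with (w + z) ≟ 0#
  ... | yes w+z≡0 = inj₁ (x+y≡0⇒x≡y w+z≡0)
  ... | no  w+z≢0 = inj₂ (x+y≡0⇒x≡y (*-integral (begin
    (w + z) * (w + (z + 1#))        ≡⟨ solve 2 (λ w z → (w :+ z) :* (w :+ (z :+ con true)) :=
                                         w :* w :+ w :+ (z :* z :+ z)) refl w z ⟩
    w * w + w + (z * z + z)         ≡⟨ cong (_+ (z * z + z)) eq ⟩
    z * z + z + (z * z + z)         ≡⟨ x+x≡0 _ ⟩
    0#                              ∎) w+z≢0))

  z≢z+1 : ∀ z → z ≢ z + 1#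
  z≢z+1 z eq = 0≢1 (begin
    0#            ≡⟨ x+x≡0 z ⟨
    z + z         ≡⟨ cong (z +_) eq ⟩
    z + (z + 1#)  ≡⟨ solve 1 (λ z → z :+ (z :+ con true) := con true) refl z ⟩
    1#            ∎)

  -- An element z² + z has trace 0, so c of nonzero trace has no solution. If Tr c = 0, Hilbert 90
  -- gives one solution, translation by 1 the other, and the fibres have no third member.
  artinSchreier-count : 1 ≤ m → ∀ c →
    ℤ.+ length (filter (λ z → (z * z + z) ≟ c) elements) ≡ ℤ.+ 1 ℤ.+ signTr c
  artinSchreier-count 1≤m c with Tr c ≟ 0#
  ... | no Trc≢0 = cong (λ xs → ℤ.+ length xs) (filter-none (λ z → (z * z + z) ≟ c)
    (All.tabulate {xs = elements} λ {z} _ z²+z≡c → Trc≢0 (trans (cong Tr (sym z²+z≡c)) (Tr-artinSchreier z))))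
  ... | yes Trc≡0 with Tr-nonzero 1≤m
  ...   | θ , Trθ≢0 with hilbert90 c θ Trc≡0 Trθ≢0
  ...     | z , z²+z≡c = cong ℤ.+_ (↭-length (unique-⊆⊇⇒↭ (Unique.filter⁺ P? unique)
              ((z≢z+1 z ∷ []) ∷ [] ∷ []) sub sup))
    where
    P? : Decidable (λ z → z * z + z ≡ c)
    P? z = (z * z + z) ≟ c
    sub : ∀ {w} → w ∈ filter P? elements → w ∈ z ∷ z + 1# ∷ []
    sub w∈ with artinSchreier-fibre (trans (proj₂ (∈-filter⁻ P? {xs = elements} w∈)) (sym z²+z≡c))
    ... | inj₁ w≡z   = here w≡z
    ... | inj₂ w≡z+1 = there (here w≡z+1)
    sup : ∀ {w} → w ∈ z ∷ z + 1# ∷ [] → w ∈ filter P? elements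
    sup (here refl) = ∈-filter⁺ P? (complete _) z²+z≡c
    sup (there (here refl)) = ∈-filter⁺ P? (complete _) (trans
      (solve 1 (λ z → (z :+ con true) :* (z :+ con true) :+ (z :+ con true) := z :* z :+ z) refl z) z²+z≡c)

  -- Each sign is 1, diminished by 2 when the trace is nonzero.
  ΣsignTr : (f : Carrier → Carrier) (xs : List Carrier) →
    ΣZ.fold (λ x → signTr (f x)) xs ≡
    ℤ.+ length xs ℤ.- ℤ.+ 2 ℤ.* ℤ.+ length (filter (λ x → ¬? (Tr (f x) ≟ 0#)) xs)
  ΣsignTr f [] = refl
  ΣsignTr f (x ∷ xs) with Tr (f x) ≟ 0#
  ... | yes _ = trans (cong (ℤ._+_ (ℤ.+ 1)) (ΣsignTr f xs))
    (ℤ-solve 2 (λ l n → ℤ-con (ℤ.+ 1) ⊕ (l ⊖ ℤ-con (ℤ.+ 2) ⊗ n) ⊜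
                        (ℤ-con (ℤ.+ 1) ⊕ l) ⊖ ℤ-con (ℤ.+ 2) ⊗ n) refl (ℤ.+ length xs) (ℤ.+ length (filter (λ x → ¬? (Tr (f x) ≟ 0#)) xs)))
  ... | no _ = trans (cong (ℤ._+_ ℤ.-[1+ 0 ]) (ΣsignTr f xs))
    (ℤ-solve 2 (λ l n → ℤ-con ℤ.-[1+ 0 ] ⊕ (l ⊖ ℤ-con (ℤ.+ 2) ⊗ n) ⊜
                        (ℤ-con (ℤ.+ 1) ⊕ l) ⊖ ℤ-con (ℤ.+ 2) ⊗ (ℤ-con (ℤ.+ 1) ⊕ n)) refl (ℤ.+ length xs) (ℤ.+ length (filter (λ x → ¬? (Tr (f x) ≟ 0#)) xs)))

  -- x ↦ 1/(ax) preserves ax + 1/x, and at its fixed point this expression vanishes.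
  2∣#Tr≢0 : ∀ {a} → a ≢ 0# → 2 ℕ∣.∣ length (filter (λ x → ¬? (Tr (a * x + inv x) ≟ 0#)) nonzero)
  2∣#Tr≢0 {a} a≢0 = involution⇒2∣length _≟_ τ (Unique.filter⁺ P? nonzero-unique)
    (λ {x} x∈ → let x≢0 = ∈⇒≢0 x∈ in
       ∈-filter⁺ P? (∈-nonzero⁺ (inv-nonzero (*-nonzero a≢0 x≢0)))
         (λ e → proj₂ (∈⇒ x∈) (trans (cong Tr (sym (τ-invariant x≢0))) e)))
    (λ x∈ → τ-involutive (∈⇒≢0 x∈))
    (λ x∈ → τ-free x∈)
    where
    P? : Decidable (λ x → Tr (a * x + inv x) ≢ 0#)
    P? x = ¬? (Tr (a * x + inv x) ≟ 0#)
    ∈⇒ : ∀ {x} → x ∈ filter P? nonzero → x ∈ nonzero × Tr (a * x + inv x) ≢ 0#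
    ∈⇒ = ∈-filter⁻ P? {xs = nonzero}
    ∈⇒≢0 : ∀ {x} → x ∈ filter P? nonzero → x ≢ 0#
    ∈⇒≢0 = ∈-nonzero⁻ ∘ proj₁ ∘ ∈⇒
    τ : Carrier → Carrier
    τ x = inv (a * x)
    aτ≡inv : ∀ {x} → x ≢ 0# → a * τ x ≡ inv x
    aτ≡inv {x} x≢0 = sym (inv-unique (begin
      x * (a * τ x) ≡⟨ solve 3 (λ x a t → x :* (a :* t) := a :* x :* t) refl x a (τ x) ⟩
      a * x * τ x   ≡⟨ inv-r _ (*-nonzero a≢0 x≢0) ⟩
      1#            ∎))
    inv-τ : ∀ {x} → x ≢ 0# → inv (τ x) ≡ a * x
    inv-τ x≢0 = inv-unique (trans (*-comm _ _) (inv-r _ (*-nonzero a≢0 x≢0)))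
    τ-invariant : ∀ {x} → x ≢ 0# → a * τ x + inv (τ x) ≡ a * x + inv x
    τ-invariant x≢0 = trans (cong₂ _+_ (aτ≡inv x≢0) (inv-τ x≢0)) (+-comm _ _)
    τ-involutive : ∀ {x} → x ≢ 0# → τ (τ x) ≡ x
    τ-involutive {x} x≢0 = inv-unique (trans (cong (_* x) (aτ≡inv x≢0)) (trans (*-comm _ _) (inv-r x x≢0)))
    τ-free : ∀ {x} → x ∈ filter P? nonzero → τ x ≢ x
    τ-free {x} x∈ τx≡x = proj₂ (∈⇒ x∈) (trans (cong Tr (begin
      a * x + inv x   ≡⟨ cong (λ t → a * t + inv x) τx≡x ⟨
      a * τ x + inv x ≡⟨ cong (_+ inv x) (aτ≡inv (∈⇒≢0 x∈)) ⟩
      inv x + inv x   ≡⟨ x+x≡0 _ ⟩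
      0#              ∎)) Tr-0)

  4∣K-3 : 2 ≤ m → ∀ {a} → a ≢ 0# → (ℤ.+ 4) ℤ∣.∣ (K a ℤ.- ℤ.+ 3)
  4∣K-3 2≤m {a} a≢0 =
    4∣l-2n-3 (ΣsignTr (λ x → a * x + inv x) nonzero)
      (subst (4 ℕ∣.∣_) (sym card-nonzero) (4∣2^ m 2≤m)) (2∣#Tr≢0 a≢0)

-- Kloosterman sums modulo three

-- Since 4 is 1 modulo 3, the residue of 2^k depends on the parity of k only; the constant `c` lets
-- one step serve both parities.
3∣2^k+c⇒3∣2^2+k+c : ∀ k c → (ℤ.+ 3) ℤ∣.∣ (ℤ.+ (2 ^ k) ℤ.+ c) → (ℤ.+ 3) ℤ∣.∣ (ℤ.+ (2 ^ (2 ℕ.+ k)) ℤ.+ c)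
3∣2^k+c⇒3∣2^2+k+c k c 3∣ = subst ((ℤ.+ 3) ℤ∣.∣_) (begin
  (ℤ.+ (2 ^ k) ℤ.+ c) ℤ.+ ℤ.+ (2 ^ k) ℤ.* ℤ.+ 3
    ≡⟨ ℤ-solve 2 (λ x c → (x ⊕ c) ⊕ x ⊗ ℤ-con (ℤ.+ 3) ⊜ ℤ-con (ℤ.+ 4) ⊗ x ⊕ c) refl (ℤ.+ (2 ^ k)) c ⟩
  ℤ.+ 4 ℤ.* ℤ.+ (2 ^ k) ℤ.+ c
    ≡⟨ cong (ℤ._+ c) (ℤ.pos-* 4 (2 ^ k)) ⟨
  ℤ.+ (4 ℕ.* 2 ^ k) ℤ.+ c
    ≡⟨ cong (λ n → ℤ.+ n ℤ.+ c) (ℕ.*-assoc 2 2 (2 ^ k)) ⟩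
  ℤ.+ (2 ^ (2 ℕ.+ k)) ℤ.+ c ∎)
  (ℤ∣.∣m∣n⇒∣m+n 3∣ (divides (ℤ.+ (2 ^ k)) refl))

3∣2^odd+1 : ∀ k → k % 2 ≡ 1 → (ℤ.+ 3) ℤ∣.∣ (ℤ.+ (2 ^ k) ℤ.+ ℤ.+ 1)
3∣2^odd+1 (suc zero)    _   = divides (ℤ.+ 1) refl
3∣2^odd+1 (suc (suc k)) odd = 3∣2^k+c⇒3∣2^2+k+c k (ℤ.+ 1) (3∣2^odd+1 k odd)

3∣2^even-1 : ∀ k → k % 2 ≡ 0 → (ℤ.+ 3) ℤ∣.∣ (ℤ.+ (2 ^ k) ℤ.- ℤ.+ 1)
3∣2^even-1 zero          _    = divides (ℤ.+ 0) refl
3∣2^even-1 (suc (suc k)) even = 3∣2^k+c⇒3∣2^2+k+c k (ℤ.- ℤ.+ 1) (3∣2^even-1 k even)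

-- Bézout: k = 4k - 3k, and 12 divides both terms.
3∣∧4∣⇒12∣ : ∀ k → (ℤ.+ 3) ℤ∣.∣ k → (ℤ.+ 4) ℤ∣.∣ k → (ℤ.+ 12) ℤ∣.∣ k
3∣∧4∣⇒12∣ k (divides c k≡3c) (divides d k≡4d) = divides (c ℤ.- d) (begin
  k
    ≡⟨ ℤ-solve 1 (λ k → k ⊜ ℤ-con (ℤ.+ 4) ⊗ k ⊖ ℤ-con (ℤ.+ 3) ⊗ k) refl k ⟩
  ℤ.+ 4 ℤ.* k ℤ.- ℤ.+ 3 ℤ.* k
    ≡⟨ cong₂ (λ s t → ℤ.+ 4 ℤ.* s ℤ.- ℤ.+ 3 ℤ.* t) k≡3c k≡4d ⟩
  ℤ.+ 4 ℤ.* (c ℤ.* ℤ.+ 3) ℤ.- ℤ.+ 3 ℤ.* (d ℤ.* ℤ.+ 4)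
    ≡⟨ ℤ-solve 2 (λ c d → ℤ-con (ℤ.+ 4) ⊗ (c ⊗ ℤ-con (ℤ.+ 3)) ⊖ ℤ-con (ℤ.+ 3) ⊗ (d ⊗ ℤ-con (ℤ.+ 4)) ⊜
         (c ⊖ d) ⊗ ℤ-con (ℤ.+ 12)) refl c d ⟩
  (c ℤ.- d) ℤ.* ℤ.+ 12 ∎)

-- The `suc` on `S` is the surplus of exceptional points: two with s = 1 against one with α = 1.
count⇒card : ∀ {S l q k} → suc l ≡ q → ℤ.+ suc S ≡ ℤ.+ l ℤ.+ k → ℤ.+ S ≡ ℤ.+ q ℤ.- ℤ.+ 2 ℤ.+ k
count⇒card {S} {l} {k = k} refl 1+S≡l+k = begin
  ℤ.+ S                             ≡⟨ ℤ-solve 1 (λ s → s ⊜ (ℤ-con (ℤ.+ 1) ⊕ s) ⊖ ℤ-con (ℤ.+ 1)) refl (ℤ.+ S) ⟩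
  ℤ.+ suc S ℤ.- ℤ.+ 1               ≡⟨ cong (ℤ._- ℤ.+ 1) 1+S≡l+k ⟩
  ℤ.+ l ℤ.+ k ℤ.- ℤ.+ 1             ≡⟨ ℤ-solve 2 (λ l k → l ⊕ k ⊖ ℤ-con (ℤ.+ 1) ⊜
                                         (ℤ-con (ℤ.+ 1) ⊕ l) ⊖ ℤ-con (ℤ.+ 2) ⊕ k) refl (ℤ.+ l) k ⟩
  ℤ.+ suc l ℤ.- ℤ.+ 2 ℤ.+ k         ∎

-- For q = -1 modulo 3 the term q - 2 vanishes and χk remains; a second factor χ removes the
-- undetermined sign.
3∣k-3 : ∀ q χ k → χ ℤ.* χ ≡ ℤ.+ 1 → (ℤ.+ 3) ℤ∣.∣ (q ℤ.+ ℤ.+ 1) →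
        (ℤ.+ 3) ℤ∣.∣ (q ℤ.- ℤ.+ 2 ℤ.+ χ ℤ.* k) → (ℤ.+ 3) ℤ∣.∣ (k ℤ.- ℤ.+ 3)
3∣k-3 q χ k χ²≡1 3∣q+1 3∣q-2+χk = ℤ∣.∣m∣n⇒∣m-n (subst ((ℤ.+ 3) ℤ∣.∣_) χ²k (ℤ∣.∣n⇒∣m*n χ 3∣χk)) ℤ∣.∣-refl
  where
  3∣χk : (ℤ.+ 3) ℤ∣.∣ (χ ℤ.* k)
  3∣χk = subst ((ℤ.+ 3) ℤ∣.∣_)
    (ℤ-solve 2 (λ q c → (q ⊖ ℤ-con (ℤ.+ 2) ⊕ c) ⊖ (q ⊕ ℤ-con (ℤ.+ 1)) ⊕ ℤ-con (ℤ.+ 3) ⊜ c) refl q (χ ℤ.* k))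
    (ℤ∣.∣m∣n⇒∣m+n (ℤ∣.∣m∣n⇒∣m-n 3∣q-2+χk 3∣q+1) ℤ∣.∣-refl)
  χ²k : χ ℤ.* (χ ℤ.* k) ≡ k
  χ²k = trans (sym (ℤ.*-assoc χ χ k)) (trans (cong (ℤ._* k) χ²≡1) (ℤ.*-identityˡ k))

-- For q = 1 modulo 3 the term q - 2 is -1, so the sign matters: χ = 1 makes k congruent to 1, hence
-- to 7.
3∣k-7 : ∀ q χ k → χ ≡ ℤ.+ 1 → (ℤ.+ 3) ℤ∣.∣ (q ℤ.- ℤ.+ 1) →
        (ℤ.+ 3) ℤ∣.∣ (q ℤ.- ℤ.+ 2 ℤ.+ χ ℤ.* k) → (ℤ.+ 3) ℤ∣.∣ (k ℤ.- ℤ.+ 7)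
3∣k-7 q _ k refl 3∣q-1 3∣q-2+k = subst ((ℤ.+ 3) ℤ∣.∣_)
  (ℤ-solve 2 (λ q k → (q ⊖ ℤ-con (ℤ.+ 2) ⊕ ℤ-con (ℤ.+ 1) ⊗ k) ⊖ (q ⊖ ℤ-con (ℤ.+ 1)) ⊖ ℤ-con (ℤ.+ 6) ⊜ k ⊖ ℤ-con (ℤ.+ 7)) refl q k)
  (ℤ∣.∣m∣n⇒∣m-n (ℤ∣.∣m∣n⇒∣m-n 3∣q-2+k 3∣q-1) (divides (ℤ.+ 2) refl))

4∣k-3⇒4∣k-7 : ∀ k → (ℤ.+ 4) ℤ∣.∣ (k ℤ.- ℤ.+ 3) → (ℤ.+ 4) ℤ∣.∣ (k ℤ.- ℤ.+ 7)
4∣k-3⇒4∣k-7 k 4∣ = subst ((ℤ.+ 4) ℤ∣.∣_)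
  (ℤ-solve 1 (λ k → (k ⊖ ℤ-con (ℤ.+ 3)) ⊖ ℤ-con (ℤ.+ 4) ⊜ k ⊖ ℤ-con (ℤ.+ 7)) refl k)
  (ℤ∣.∣m∣n⇒∣m-n 4∣ ℤ∣.∣-refl)

-- The cubic and its Artin-Schreier model

module Curve {m : ℕ} (1≤m : 1 ≤ m) (F : FiniteField m) {ξ : FiniteField.Carrier F}
  (ξ≢0 : ξ ≢ FiniteField.0# F) (ξ≢1 : ξ ≢ FiniteField.1# F) where
  open FiniteField F
  open FieldTheory F
  open Kloosterman F
  open IsCommutativeRing isCommutativeRing
    using (*-comm; *-identityˡ; *-identityʳ; zeroˡ)

  a : Carrier
  a = pow ξ 4 + pow ξ 3

  a≢0 : a ≢ 0#
  a≢0 a≡0 = *-nonzero (pow-nonzero ξ≢0 3) (x≢y⇒x+y≢0 ξ≢1) (trans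
    (solve 1 (λ ξ → ξ :* (ξ :* (ξ :* con true)) :* (ξ :+ con true) :=
       ξ :* (ξ :* (ξ :* (ξ :* con true))) :+ ξ :* (ξ :* (ξ :* con true))) refl ξ) a≡0)

  cube : Carrier → Carrier
  cube u = u * (u * u)

  pairs : List (Carrier × Carrier)
  pairs = cartesianProduct elements elements

  pairs-unique : Unique pairs
  pairs-unique = Unique.cartesianProduct⁺ unique unique

  ∈-pairs : ∀ p → p ∈ pairs
  ∈-pairs (x , y) = ∈-cartesianProduct⁺ (complete x) (complete y)

  -- On the cubic, γ = 1 + α + β is eliminated. The other equation is cleared of the denominator s,
  -- so it is meaningful for all pairs; at s = 0 it reads 0 = ξ and has no solutions.
  OnCubic OnArtinSchreier : Carrier × Carrier → Set
  OnCubic (α , β) = α * (β * (1# + α + β)) ≡ ξ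
  OnArtinSchreier (s , z) = s * (z * z + z) ≡ ξ * cube (1# + s)

  onCubic? : Decidable OnCubic
  onCubic? (α , β) = (α * (β * (1# + α + β))) ≟ ξ

  onArtinSchreier? : Decidable OnArtinSchreier
  onArtinSchreier? (s , z) = (s * (z * z + z)) ≟ (ξ * cube (1# + s))

  cubic artinSchreier : List (Carrier × Carrier)
  cubic = filter onCubic? pairs
  artinSchreier = filter onArtinSchreier? pairs

  -- (α , β) stands for a solution of α + β + γ = 1, αβγ = ξ; the three variables are rotated.
  3∣#cubic : 3 ℕ∣.∣ length cubic
  3∣#cubic = rotation⇒3∣length (≡-dec _≟_ _≟_) ρ (Unique.filter⁺ onCubic? pairs-unique)
    (λ {p} p∈ → ∈-filter⁺ onCubic? (∈-pairs (ρ p)) (ρ-onCubic p (∈⇒onCubic p∈)))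
    (λ {p} _ → ρ³ p)
    (λ {p} p∈ → ρ-free p (∈⇒onCubic p∈))
    where
    ρ : Carrier × Carrier → Carrier × Carrier
    ρ (α , β) = β , 1# + α + β
    ∈⇒onCubic : ∀ {p} → p ∈ cubic → OnCubic p
    ∈⇒onCubic = proj₂ ∘ ∈-filter⁻ onCubic? {xs = pairs}
    ρ-onCubic : ∀ p → OnCubic p → OnCubic (ρ p)
    ρ-onCubic (α , β) = trans (solve 2 (λ α β → β :* ((con true :+ α :+ β) :* (con true :+ β :+ (con true :+ α :+ β))) :=
      α :* (β :* (con true :+ α :+ β))) refl α β)
    ρ³ : ∀ p → ρ (ρ (ρ p)) ≡ p
    ρ³ (α , β) = cong₂ _,_
      (solve 2 (λ α β → con true :+ β :+ (con true :+ α :+ β) := α) refl α β)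
      (solve 2 (λ α β → con true :+ (con true :+ α :+ β) :+ (con true :+ β :+ (con true :+ α :+ β)) := β) refl α β)
    -- A fixed point has α = β = γ; their sum 3α = α is 1, so the product ξ would be 1.
    ρ-free : ∀ p → OnCubic p → ρ p ≢ p
    ρ-free (α , β) on eq = ξ≢1 (begin
      ξ                         ≡⟨ on ⟨
      α * (β * (1# + α + β))    ≡⟨ cong₂ (λ s t → s * (t * (1# + s + t))) (trans (sym β≡α) β≡1) β≡1 ⟩
      1# * (1# * (1# + 1# + 1#)) ≡⟨ solve 0 (con true :* (con true :* (con true :+ con true :+ con true)) := con true) refl ⟩
      1#                        ∎)
      where
      β≡α = cong proj₁ eq
      β≡1 : β ≡ 1#
      β≡1 = begin
        β           ≡⟨ cong proj₂ eq ⟨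
        1# + α + β  ≡⟨ cong (λ t → 1# + t + β) β≡α ⟨
        1# + β + β  ≡⟨ solve 1 (λ β → con true :+ β :+ β := con true) refl β ⟩
        1#          ∎

  OffOne : Carrier × Carrier → Set
  OffOne (s , _) = s ≢ 1#

  offOne? : Decidable OffOne
  offOne? (s , _) = ¬? (s ≟ 1#)

  -- Since 1 + s/(1 + s) = 1/(1 + s) in characteristic two, the substitution is its own inverse
  -- where s ≠ 1, and one formula serves both directions.
  ψ : Carrier × Carrier → Carrier × Carrier
  ψ (s , z) = s * inv (1# + s) , z * inv (1# + s)

  module _ {s : Carrier} (s≢1 : s ≢ 1#) where
    private
      u t : Carrier
      u = 1# + s
      t = inv u

      ut≡1 : u * t ≡ 1#
      ut≡1 = inv-r u (x≢y⇒x+y≢0 (s≢1 ∘ sym))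

      1+st≡t : 1# + s * t ≡ t
      1+st≡t = begin
        1# + s * t    ≡⟨ cong (_+ s * t) ut≡1 ⟨
        u * t + s * t ≡⟨ solve 2 (λ s t → (con true :+ s) :* t :+ s :* t := t) refl s t ⟩
        t             ∎

    ψ-offOne : ∀ z → OffOne (ψ (s , z))
    ψ-offOne z st≡1 = inv-nonzero (invertible⇒nonzero ut≡1)
      (trans (sym 1+st≡t) (trans (cong (1# +_) st≡1) 1+1≡0))

    ψ-involutive : ∀ z → ψ (ψ (s , z)) ≡ (s , z)
    ψ-involutive z = cong₂ _,_ (undo s) (undo z)
      where
      undo : ∀ w → w * t * inv (1# + s * t) ≡ w
      undo w = begin
        w * t * inv (1# + s * t) ≡⟨ cong (λ r → w * t * inv r) 1+st≡t ⟩
        w * t * inv t            ≡⟨ cong (w * t *_) (inv-unique (trans (*-comm _ _) ut≡1)) ⟩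
        w * t * u                ≡⟨ solve 3 (λ w t u → w :* t :* u := w :* (u :* t)) refl w t u ⟩
        w * (u * t)              ≡⟨ cong (w *_) ut≡1 ⟩
        w * 1#                   ≡⟨ *-identityʳ w ⟩
        w                        ∎

    ψ-onCubic : ∀ z → OnArtinSchreier (s , z) → OnCubic (ψ (s , z))
    ψ-onCubic z on = begin
      s * t * (z * t * (1# + s * t + z * t))    ≡⟨ cong (λ r → s * t * (z * t * (r + z * t))) 1+st≡t ⟩
      s * t * (z * t * (t + z * t))             ≡⟨ solve 3 (λ s z t → s :* t :* (z :* t :* (t :+ z :* t)) :=
                                                     s :* (z :* z :+ z) :* (t :* (t :* t))) refl s z t ⟩
      s * (z * z + z) * cube t                  ≡⟨ cong (_* cube t) on ⟩
      ξ * cube u * cube t                       ≡⟨ solve 3 (λ ξ u t → ξ :* (u :* (u :* u)) :* (t :* (t :* t)) :=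
                                                     ξ :* (u :* t :* (u :* t :* (u :* t)))) refl ξ u t ⟩
      ξ * cube (u * t)                          ≡⟨ cong (λ r → ξ * cube r) ut≡1 ⟩
      ξ * cube 1#                               ≡⟨ solve 1 (λ ξ → ξ :* (con true :* (con true :* con true)) := ξ) refl ξ ⟩
      ξ                                         ∎

    ψ-onArtinSchreier : ∀ z → OnCubic (s , z) → OnArtinSchreier (ψ (s , z))
    ψ-onArtinSchreier z on = begin
      s * t * (z * t * (z * t) + z * t)         ≡⟨ solve 3 (λ s z t → s :* t :* (z :* t :* (z :* t) :+ z :* t) :=
                                                     s :* z :* (t :* t) :* (con true :+ z :* t)) refl s z t ⟩
      s * z * (t * t) * (1# + z * t)            ≡⟨ cong (λ r → s * z * (t * t) * (r + z * t)) ut≡1 ⟨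
      s * z * (t * t) * (u * t + z * t)         ≡⟨ solve 3 (λ s z t → s :* z :* (t :* t) :* ((con true :+ s) :* t :+ z :* t) :=
                                                     s :* (z :* (con true :+ s :+ z)) :* (t :* (t :* t))) refl s z t ⟩
      s * (z * (1# + s + z)) * cube t           ≡⟨ cong (_* cube t) on ⟩
      ξ * cube t                                ≡⟨ cong (λ r → ξ * cube r) 1+st≡t ⟨
      ξ * cube (1# + s * t)                     ∎

  -- Kept general in `P` and `Q` so that the two curves can exchange roles, giving both
  -- inequalities.
  ψ-length≤ : {P Q : Carrier × Carrier → Set} (P? : Decidable P) (Q? : Decidable Q) →
    (∀ {s} → s ≢ 1# → ∀ z → P (s , z) → Q (ψ (s , z))) →
    length (filter offOne? (filter P? pairs)) ≤ length (filter offOne? (filter Q? pairs))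
  ψ-length≤ {P} P? Q? P⇒Q = injection⇒length≤ ψ (Unique.filter⁺ offOne? (Unique.filter⁺ P? pairs-unique))
    (λ {p} p∈ → let off , on = ∈⇒ p∈ in
      ∈-filter⁺ offOne? (∈-filter⁺ Q? (∈-pairs (ψ p)) (P⇒Q off _ on)) (ψ-offOne off (proj₂ p)))
    (λ p∈ q∈ ψp≡ψq → trans (sym (ψ-involutive (proj₁ (∈⇒ p∈)) _))
      (trans (cong ψ ψp≡ψq) (ψ-involutive (proj₁ (∈⇒ q∈)) _)))
    where
    ∈⇒ : ∀ {p} → p ∈ filter offOne? (filter P? pairs) → OffOne p × P p
    ∈⇒ p∈ = let p∈′ , off = ∈-filter⁻ offOne? {xs = filter P? pairs} p∈
            in off , proj₂ (∈-filter⁻ P? {xs = pairs} p∈′)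

  #offOne : length (filter offOne? cubic) ≡ length (filter offOne? artinSchreier)
  #offOne = ℕ.≤-antisym (ψ-length≤ onCubic? onArtinSchreier? ψ-onArtinSchreier)
                        (ψ-length≤ onArtinSchreier? onCubic? ψ-onCubic)

  ¬offOne⇒≡1 : ∀ {p} → ¬ OffOne p → proj₁ p ≡ 1#
  ¬offOne⇒≡1 {s , _} = decidable-stable (s ≟ 1#)

  -- The remaining point is (1 , √ξ).
  #cubic : length cubic ≡ 1 ℕ.+ length (filter offOne? cubic)
  #cubic with sqrt ξ
  ... | r , r²≡ξ = ↭-length (unique-remove offOne? ((1# , r) ∷ [])
    (Unique.filter⁺ onCubic? pairs-unique) ([] ∷ [])
    (λ { (here refl) → ∈-filter⁺ onCubic? (∈-pairs _) (trans (onCubic-1 r) r²≡ξ) })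
    (λ { (here refl) off → off refl })
    λ {p} p∈ ¬off → here (at-1 (¬offOne⇒≡1 {p} ¬off) (proj₂ (∈-filter⁻ onCubic? {xs = pairs} p∈))))
    where
    onCubic-1 : ∀ β → 1# * (β * (1# + 1# + β)) ≡ β * β
    onCubic-1 = solve 1 (λ β → con true :* (β :* (con true :+ con true :+ β)) := β :* β) refl
    at-1 : ∀ {α β} → α ≡ 1# → OnCubic (α , β) → (α , β) ≡ (1# , r)
    at-1 {β = β} refl on = cong (1# ,_) (square-injective (trans (sym (onCubic-1 β)) (trans on (sym r²≡ξ))))

  -- The remaining points are (1 , 0) and (1 , 1).
  #artinSchreier : length artinSchreier ≡ 2 ℕ.+ length (filter offOne? artinSchreier)
  #artinSchreier = ↭-length (unique-remove offOne? ((1# , 0#) ∷ (1# , 0# + 1#) ∷ [])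
    (Unique.filter⁺ onArtinSchreier? pairs-unique) (((z≢z+1 0# ∘ cong proj₂) ∷ []) ∷ [] ∷ [])
    (λ { (here refl) → ∈-filter⁺ onArtinSchreier? (∈-pairs _)
           (solve 1 (λ ξ → con true :* (con false :* con false :+ con false) := rhs ξ) refl ξ)
       ; (there (here refl)) → ∈-filter⁺ onArtinSchreier? (∈-pairs _)
           (solve 1 (λ ξ → con true :* ((con false :+ con true) :* (con false :+ con true) :+ (con false :+ con true)) := rhs ξ) refl ξ) })
    (λ { (here refl) off → off refl ; (there (here refl)) off → off refl })
    λ {p} p∈ ¬off → at-1 (¬offOne⇒≡1 {p} ¬off) (proj₂ (∈-filter⁻ onArtinSchreier? {xs = pairs} p∈)))
    where
    rhs = λ ξ → ξ :* ((con true :+ con true) :* ((con true :+ con true) :* (con true :+ con true)))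
    at-1 : ∀ {s z} → s ≡ 1# → OnArtinSchreier (s , z) → (s , z) ∈ (1# , 0#) ∷ (1# , 0# + 1#) ∷ []
    -- At s = 1 the right side vanishes, so z lies in the fibre through 0; this explains the form
    -- `0# + 1#` of the second point.
    at-1 {z = z} refl on with artinSchreier-fibre {z} {0#} (begin
      z * z + z         ≡⟨ *-identityˡ _ ⟨
      1# * (z * z + z)  ≡⟨ on ⟩
      ξ * cube (1# + 1#) ≡⟨ solve 1 (λ ξ → rhs ξ := con false :* con false :+ con false) refl ξ ⟩
      0# * 0# + 0#      ∎)
    ... | inj₁ refl = here refl
    ... | inj₂ refl = there (here refl)

  -- With v = (s/ξ)², the two arguments of signTr differ by h² + h for h = ξ/s + ξs.
  signTr-reparametrise : ∀ {s} → s ≢ 0# → let v = s * inv ξ * (s * inv ξ) in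
    signTr (ξ * cube (1# + s) * inv s) ≡ signTr ξ ℤ.* signTr (a * v + inv v)
  signTr-reparametrise {s} s≢0 = begin
    signTr (ξ * cube (1# + s) * i)                  ≡⟨ cong signTr difference ⟩
    signTr (h * h + h + (ξ + (a * v + inv v)))      ≡⟨ signTr-artinSchreier h _ ⟩
    signTr (ξ + (a * v + inv v))                    ≡⟨ signTr-+ ξ _ ⟩
    signTr ξ ℤ.* signTr (a * v + inv v)             ∎
    where
    i = inv s
    j = inv ξ
    v = s * j * (s * j)
    h = ξ * i + ξ * s
    si≡1 = inv-r s s≢0
    ξj≡1 = inv-r ξ ξ≢0
    inv-v : inv v ≡ ξ * i * (ξ * i)
    inv-v = inv-unique (begin
      v * (ξ * i * (ξ * i))             ≡⟨ solve 4 (λ s j ξ i → s :* j :* (s :* j) :* (ξ :* i :* (ξ :* i)) :=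
                                             s :* i :* (s :* i) :* (ξ :* j :* (ξ :* j))) refl s j ξ i ⟩
      s * i * (s * i) * (ξ * j * (ξ * j)) ≡⟨ cong₂ (λ x y → x * x * (y * y)) si≡1 ξj≡1 ⟩
      1# * 1# * (1# * 1#)               ≡⟨ solve 0 (con true :* con true :* (con true :* con true) := con true) refl ⟩
      1#                                ∎)
    a*v : a * v ≡ (ξ * ξ + ξ) * (s * s)
    a*v = begin
      a * v ≡⟨ solve 3 (λ ξ s j → (ξ :* (ξ :* (ξ :* (ξ :* con true))) :+ ξ :* (ξ :* (ξ :* con true))) :* (s :* j :* (s :* j)) :=
                 (ξ :* ξ :+ ξ) :* (s :* s) :* (ξ :* j :* (ξ :* j))) refl ξ s j ⟩
      (ξ * ξ + ξ) * (s * s) * (ξ * j * (ξ * j)) ≡⟨ cong (λ y → (ξ * ξ + ξ) * (s * s) * (y * y)) ξj≡1 ⟩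
      (ξ * ξ + ξ) * (s * s) * (1# * 1#) ≡⟨ solve 1 (λ x → x :* (con true :* con true) := x) refl _ ⟩
      (ξ * ξ + ξ) * (s * s) ∎
    difference : ξ * cube (1# + s) * i ≡ h * h + h + (ξ + (a * v + inv v))
    difference = begin
      ξ * cube (1# + s) * i
        ≡⟨ solve 3 (λ ξ s i → ξ :* ((con true :+ s) :* ((con true :+ s) :* (con true :+ s))) :* i :=
             ξ :* (i :+ s :* i :* (con true :+ s :+ s :* s))) refl ξ s i ⟩
      ξ * (i + s * i * (1# + s + s * s))
        ≡⟨ cong (λ x → ξ * (i + x * (1# + s + s * s))) si≡1 ⟩
      ξ * (i + 1# * (1# + s + s * s))
        ≡⟨ solve 3 (λ ξ s i → ξ :* (i :+ con true :* (con true :+ s :+ s :* s)) :=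
             (ξ :* i :+ ξ :* s) :* (ξ :* i :+ ξ :* s) :+ (ξ :* i :+ ξ :* s) :+
             (ξ :+ ((ξ :* ξ :+ ξ) :* (s :* s) :+ ξ :* i :* (ξ :* i)))) refl ξ s i ⟩
      h * h + h + (ξ + ((ξ * ξ + ξ) * (s * s) + ξ * i * (ξ * i)))
        ≡⟨ cong₂ (λ x y → h * h + h + (ξ + (x + y))) a*v inv-v ⟨
      h * h + h + (ξ + (a * v + inv v)) ∎

  -- Counting the Artin-Schreier model by fibres over s

  fibre : Carrier → ℕ
  fibre s = length (filter (λ z → onArtinSchreier? (s , z)) elements)

  fibre-0 : fibre 0# ≡ 0
  fibre-0 = cong length (filter-none (λ z → onArtinSchreier? (0# , z)) (All.tabulate {xs = elements} λ {z} _ on →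
    ξ≢0 (begin
      ξ                   ≡⟨ solve 1 (λ ξ → ξ := ξ :* ((con true :+ con false) :* ((con true :+ con false) :* (con true :+ con false)))) refl ξ ⟩
      ξ * cube (1# + 0#)  ≡⟨ on ⟨
      0# * (z * z + z)    ≡⟨ zeroˡ _ ⟩
      0#                  ∎)))

  fibre-nonzero : ∀ {s} → s ≢ 0# → let v = s * inv ξ * (s * inv ξ) in
    ℤ.+ fibre s ≡ ℤ.+ 1 ℤ.+ signTr ξ ℤ.* signTr (a * v + inv v)
  fibre-nonzero {s} s≢0 = begin
    ℤ.+ fibre s
      ≡⟨ cong (λ xs → ℤ.+ length xs) (filter-≐ (λ z → onArtinSchreier? (s , z)) (λ z → (z * z + z) ≟ c) (to , from) elements) ⟩
    ℤ.+ length (filter (λ z → (z * z + z) ≟ c) elements)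
      ≡⟨ artinSchreier-count 1≤m c ⟩
    ℤ.+ 1 ℤ.+ signTr c
      ≡⟨ cong (ℤ._+_ (ℤ.+ 1)) (signTr-reparametrise s≢0) ⟩
    _ ∎
    where
    c = ξ * cube (1# + s) * inv s
    sc : s * c ≡ ξ * cube (1# + s)
    sc = begin
      s * (ξ * cube (1# + s) * inv s) ≡⟨ solve 3 (λ s x i → s :* (x :* i) := x :* (s :* i)) refl s _ (inv s) ⟩
      ξ * cube (1# + s) * (s * inv s) ≡⟨ cong (ξ * cube (1# + s) *_) (inv-r s s≢0) ⟩
      ξ * cube (1# + s) * 1#          ≡⟨ *-identityʳ _ ⟩
      ξ * cube (1# + s)               ∎
    to : ∀ {z} → OnArtinSchreier (s , z) → z * z + z ≡ c
    to on = *-cancelˡ s≢0 (trans on (sym sc))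
    from : ∀ {z} → z * z + z ≡ c → OnArtinSchreier (s , z)
    from eq = trans (cong (s *_) eq) sc

  #artinSchreier-K : ℤ.+ length artinSchreier ≡ ℤ.+ length nonzero ℤ.+ signTr ξ ℤ.* K a
  #artinSchreier-K = begin
    ℤ.+ length artinSchreier
      ≡⟨ cong ℤ.+_ (length-filter-cartesianProduct onArtinSchreier? elements elements) ⟩
    ℤ.+ ΣN.fold fibre elements
      ≡⟨ cong ℤ.+_ (ΣN.fold-↭ fibre elements↭) ⟩
    ℤ.+ (fibre 0# ℕ.+ ΣN.fold fibre nonzero)
      ≡⟨ cong (λ n → ℤ.+ (n ℕ.+ ΣN.fold fibre nonzero)) fibre-0 ⟩
    ℤ.+ ΣN.fold fibre nonzero
      ≡⟨ ΣN⇒ΣZ fibre nonzero ⟩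
    ΣZ.fold (λ s → ℤ.+ fibre s) nonzero
      ≡⟨ ΣZ.fold-cong nonzero (λ s∈ → fibre-nonzero (∈-nonzero⁻ s∈)) ⟩
    ΣZ.fold (λ s → ℤ.+ 1 ℤ.+ signTr ξ ℤ.* κ (v s)) nonzero
      ≡⟨ ΣZ.fold-∙ (const (ℤ.+ 1)) (λ s → signTr ξ ℤ.* κ (v s)) nonzero ⟩
    ΣZ.fold (const (ℤ.+ 1)) nonzero ℤ.+ ΣZ.fold (λ s → signTr ξ ℤ.* κ (v s)) nonzero
      ≡⟨ cong₂ ℤ._+_ (ΣZ-const-1 nonzero) (ΣZ-* (signTr ξ) (κ ∘ v) nonzero) ⟩
    ℤ.+ length nonzero ℤ.+ signTr ξ ℤ.* ΣZ.fold (κ ∘ v) nonzero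
      ≡⟨ cong (λ k → ℤ.+ length nonzero ℤ.+ signTr ξ ℤ.* k)
           (trans (sym (ΣZ.fold-map κ v nonzero)) (ΣZ.fold-↭ κ v-permutes)) ⟩
    ℤ.+ length nonzero ℤ.+ signTr ξ ℤ.* K a ∎
    where
    κ : Carrier → ℤ
    κ x = signTr (a * x + inv x)
    v : Carrier → Carrier
    v s = s * inv ξ * (s * inv ξ)
    j≢0 = inv-nonzero ξ≢0
    -- Scaling by 1/ξ and squaring are both injective on nonzero elements, so v can replace s as the
    -- summation variable.
    v-permutes : map v nonzero ↭ nonzero
    v-permutes = injection⇒↭ v nonzero-unique
      (λ s∈ → let sj≢0 = *-nonzero (∈-nonzero⁻ s∈) j≢0 in ∈-nonzero⁺ (*-nonzero sj≢0 sj≢0))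
      (λ {s} {s′} _ _ eq → *-cancelˡ j≢0
        (trans (*-comm _ _) (trans (square-injective eq) (*-comm _ _))))

  3∣card-2+K : (ℤ.+ 3) ℤ∣.∣ (ℤ.+ (2 ^ m) ℤ.- ℤ.+ 2 ℤ.+ signTr ξ ℤ.* K a)
  3∣card-2+K = subst ((ℤ.+ 3) ℤ∣.∣_) (count⇒card card-nonzero #Q) (ℤ∣.∣ᵤ⇒∣ 3∣#cubic)
    where
    #Q : ℤ.+ suc (length cubic) ≡ ℤ.+ length nonzero ℤ.+ signTr ξ ℤ.* K a
    #Q = trans (cong ℤ.+_ (trans (cong suc (trans #cubic (cong suc #offOne))) (sym #artinSchreier))) #artinSchreier-K

-- The trace of ξ and the congruences modulo twelve

even⇒signTr-ξ≡1 : {m : ℕ} (F : FiniteField m) → let open FiniteField F in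
  m % 2 ≡ 0 → ∀ b → signTr (pow b 4 + b + 1#) ≡ ℤ.+ 1
even⇒signTr-ξ≡1 F even b = signTr-0 (begin
  Tr (pow b 4 + b + 1#)         ≡⟨ Tr-+ _ _ ⟩
  Tr (pow b 4 + b) + Tr 1#      ≡⟨ cong₂ _+_ (Tr-+ _ _) (Tr-1-even even) ⟩
  Tr (pow b 4) + Tr b + 0#      ≡⟨ cong (λ t → t + Tr b + 0#) Tr-b⁴ ⟩
  Tr b + Tr b + 0#              ≡⟨ solve 1 (λ t → t :+ t :+ con false := con false) refl (Tr b) ⟩
  0#                            ∎)
  where
  open FiniteField F
  open FieldTheory F
  open Kloosterman F
  -- The shape of ξ enters here: b⁴ is a Frobenius conjugate of b, so their traces cancel.
  Tr-b⁴ : Tr (pow b 4) ≡ Tr b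
  Tr-b⁴ = begin
    Tr (pow b 4)        ≡⟨ cong Tr (solve 1 (λ b → b :* (b :* (b :* (b :* con true))) := b :* b :* (b :* b)) refl b) ⟩
    Tr (b * b * (b * b)) ≡⟨ Tr-square _ ⟩
    Tr (b * b)          ≡⟨ Tr-square b ⟩
    Tr b                ∎

3≤card⇒2≤m : ∀ m → 3 ≤ 2 ^ m → 2 ≤ m
3≤card⇒2≤m zero          (s≤s ())
3≤card⇒2≤m (suc zero)    (s≤s (s≤s ()))
3≤card⇒2≤m (suc (suc m)) _ = s≤s (s≤s z≤n)

open import Data.Integer using (+_; _-_)
open import Data.Integer.Divisibility using (_∣_)

theorem4 : (m : ℕ) → 1 ≤ m → (F : FiniteField m) → (b : FiniteField.Carrier F) →
    let open FiniteField F
        ξ = pow b 4 + b + 1#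
        a = pow ξ 4 + pow ξ 3
    in ¬ (ξ ≡ 0#) → ¬ (ξ ≡ 1#) →
       (m % 2 ≡ 1 → (+ 12) ∣ (K a - + 3)) × (m % 2 ≡ 0 → (+ 12) ∣ (K a - + 7))
theorem4 m 1≤m F b ξ≢0 ξ≢1 =
  (λ odd → ℤ∣.∣⇒∣ᵤ (3∣∧4∣⇒12∣ (k - + 3)
    (3∣k-3 q (signTr ξ) k (signTr-square ξ) (3∣2^odd+1 m odd) 3∣card-2+K) 4∣)) ,
  (λ even → ℤ∣.∣⇒∣ᵤ (3∣∧4∣⇒12∣ (k - + 7)
    (3∣k-7 q (signTr ξ) k (even⇒signTr-ξ≡1 F even b) (3∣2^even-1 m even) 3∣card-2+K) (4∣k-3⇒4∣k-7 k 4∣)))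
  where
  open FiniteField F using (pow; 1#; 0≢1; complete; card; signTr; K) renaming (_+_ to _+F_)
  ξ = pow b 4 +F b +F 1#
  open Kloosterman F
  open Curve 1≤m F {ξ} ξ≢0 ξ≢1
  -- 0, 1 and ξ are three distinct elements, so the field is larger than 𝔽₂ and 4 divides its order.
  2≤m : 2 ≤ m
  2≤m = 3≤card⇒2≤m m (subst (3 ≤_) card (unique-⊆⇒length≤
    ((0≢1 ∷ (ξ≢0 ∘ sym) ∷ []) ∷ ((ξ≢1 ∘ sym) ∷ []) ∷ [] ∷ []) (λ {x} _ → complete x)))
  q = + (2 ^ m)
  k = K a
  4∣ = 4∣K-3 2≤m a≢0
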